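{- Let $\mathcal C$ be a class of cographs. The following statements are equivalent: (1) $\mathcal C$ is $\mathrm{MSO}_1$-orderable. (2) $\mathcal C$ has property $\mathsf{CUT}$. (3) There exists a constant $d\in\mathbb N$ such that the cotree of every graph in $\mathcal C$ has outdegree at most $d$.
   Context: Graphs are finite, simple, undirected. $G\oplus H$ is the disjoint union and $G\otimes H$ is the disjoint union plus all edges between a vertex of $G$ and a vertex of $H$. A cograph is a graph built from single vertices (constant $1$) by $\oplus$ and $\otimes$; viewing $\oplus,\otimes$ as associative commutative operations of variable arity with unordered arguments, a cotree is a term over $\oplus,\otimes,1$ in which no node is labelled by the same operation as one of its immediate successors; every cograph has a unique cotree. For a graph $G=\langle V,E\rangle$, $\lfloor G\rfloor=\langle V,\mathrm{edg}\rangle$; $\mathcal C$ is $\mathrm{MSO}_1$-orderable if there is an MSO-formula $\varphi(x,y;\bar Z)$ such that for each nonempty $G\in\mathcal C$ there are sets $\bar P\subseteq V$ with $\{(a,b):\lfloor G\rfloor\models\varphi(a,b;\bar P)\}$ a linear order on $V$. A graph with ports in $[k]=\{0,\dots,k-1\}$ is a graph with a labelling $\pi:V\to[k]$. For $R\subseteq[k]\times[k]$ and graphs $G,H$ with ports in $[k]$, $G\otimes_R H$ is the disjoint union of $G$ and $H$ plus all edges $(x,y)$ with $x$ in one of the graphs, $y$ in the other, and the port labels $(a,b)$ of $x,y$ satisfying $(a,b)\in R$; $\mathrm{Del}$ deletes port labels. $\mathrm{Cut}(G,k)$ is the maximal $n$ such that there are nonempty graphs $H_0,\dots,H_{n-1}$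 with ports in $[k]$ and $R\subseteq[k]\times[k]$ with $G\cong\mathrm{Del}(H_0\otimes_R\cdots\otimes_R H_{n-1})$. $\mathcal C$ has property $\mathsf{CUT}(f)$ if $\mathrm{Cut}(G,k)\le f(k)$ for all $G\in\mathcal C$ and $k\in\mathbb N$, and property $\mathsf{CUT}$ if it has $\mathsf{CUT}(f)$ for some $f:\mathbb N\to\mathbb N$. -}

module Defs where

open import Data.Nat using (ℕ; zero; suc; _+_; _≤_; _⊔_)
open import Data.Fin using (Fin; splitAt)
import Data.Fin as Fin
open import Data.Bool using (Bool; true; false; _∧_; _∨_; if_then_else_)
open import Data.Sum using (_⊎_; inj₁; inj₂)
open import Data.Product using (Σ; ∃; _×_; _,_; ∃-syntax)
open import Data.List using (List; []; _∷_; length)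
open import Data.List.Relation.Unary.All using (All)
open import Data.Vec using (Vec; []; _∷_)
open import Data.Vec.Relation.Unary.All using () renaming (All to AllV)
open import Data.Maybe using (Maybe; just; nothing)
open import Data.Empty using (⊥)
open import Relation.Nullary using (¬_)
open import Relation.Binary.PropositionalEquality using (_≡_)
open import Relation.Binary.Structures using (IsTotalOrder)
open import Function.Bundles using (_↔_; Inverse)
open import Function.Bundles using (_⇔_)

record RawGraph : Set where
  field
    size : ℕ
    adj  : Fin size → Fin size → Bool
open RawGraph public

record IsSimple (G : RawGraph) : Set where
  field
    symmetric   : ∀ x y → adj G x y ≡ adj G y x
    irreflexive : ∀ x → adj G x x ≡ false

record Graph : Set where
  field
    raw    : RawGraph
    simple : IsSimple raw
open Graph public

_≅_ : RawGraph → RawGraph → Set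
G ≅ H = Σ (Fin (size G) ↔ Fin (size H)) λ f →
          ∀ x y → adj G x y ≡ adj H (Inverse.to f x) (Inverse.to f y)

pairAdj : ∀ {n m} → (Fin n → Fin n → Bool) → (Fin m → Fin m → Bool) →
          (Fin n → Fin m → Bool) → Fin (n + m) → Fin (n + m) → Bool
pairAdj {n} aG aH cross x y with splitAt n x | splitAt n y
... | inj₁ a | inj₁ b = aG a b
... | inj₂ a | inj₂ b = aH a b
... | inj₁ a | inj₂ b = cross a b
... | inj₂ a | inj₁ b = cross b a

single : RawGraph
single = record { size = 1 ; adj = λ _ _ → false }

emptyG : RawGraph
emptyG = record { size = 0 ; adj = λ _ _ → false }

_⊕_ : RawGraph → RawGraph → RawGraph
G ⊕ H = record { size = size G + size H
               ; adj = pairAdj (adj G) (adj H) (λ _ _ → false) }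

_⊗_ : RawGraph → RawGraph → RawGraph
G ⊗ H = record { size = size G + size H
               ; adj = pairAdj (adj G) (adj H) (λ _ _ → true) }

data Op : Set where
  ⊕op ⊗op : Op

data Cotree : Set where
  leaf : Cotree
  node : Op → List Cotree → Cotree

label : Cotree → Maybe Op
label leaf       = nothing
label (node o _) = just o

data ValidCotree : Cotree → Set where
  leaf-valid : ValidCotree leaf
  node-valid : ∀ o ts → 2 ≤ length ts → All ValidCotree ts →
               All (λ t → ¬ (label t ≡ just o)) ts → ValidCotree (node o ts)

opG : Op → RawGraph → RawGraph → RawGraph
opG ⊕op = _⊕_
opG ⊗op = _⊗_

mutual
  ⟦_⟧ : Cotree → RawGraph
  ⟦ leaf ⟧      = single
  ⟦ node o ts ⟧ = ⟦ o ∣ ts ⟧s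

  ⟦_∣_⟧s : Op → List Cotree → RawGraph
  ⟦ o ∣ [] ⟧s     = emptyG
  ⟦ o ∣ t ∷ ts ⟧s = opG o ⟦ t ⟧ ⟦ o ∣ ts ⟧s

mutual
  outdeg : Cotree → ℕ
  outdeg leaf        = 0
  outdeg (node _ ts) = length ts ⊔ outdegs ts

  outdegs : List Cotree → ℕ
  outdegs []       = 0
  outdegs (t ∷ ts) = outdeg t ⊔ outdegs ts

IsCograph : Graph → Set
IsCograph G = ∃[ T ] (ValidCotree T × (raw G ≅ ⟦ T ⟧))

-- MSO formulas over the signature {edg}; de Bruijn indexed
-- i first-order variables, j set variables in scope.

data Formula : ℕ → ℕ → Set where
  eq   : ∀ {i j} → Fin i → Fin i → Formula i j
  edg  : ∀ {i j} → Fin i → Fin i → Formula i j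
  mem  : ∀ {i j} → Fin i → Fin j → Formula i j
  neg  : ∀ {i j} → Formula i j → Formula i j
  conj : ∀ {i j} → Formula i j → Formula i j → Formula i j
  ex₁  : ∀ {i j} → Formula (suc i) j → Formula i j
  ex₂  : ∀ {i j} → Formula i (suc j) → Formula i j

extend : ∀ {A : Set} {i} → A → (Fin i → A) → Fin (suc i) → A
extend a ρ Fin.zero    = a
extend a ρ (Fin.suc k) = ρ k

Subset : ℕ → Set
Subset n = Fin n → Bool

Sat : (G : RawGraph) → ∀ {i j} → (Fin i → Fin (size G)) →
      (Fin j → Subset (size G)) → Formula i j → Set
Sat G ρ σ (eq x y)   = ρ x ≡ ρ y
Sat G ρ σ (edg x y)  = adj G (ρ x) (ρ y) ≡ true
Sat G ρ σ (mem x X)  = σ X (ρ x) ≡ true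
Sat G ρ σ (neg φ)    = ¬ Sat G ρ σ φ
Sat G ρ σ (conj φ ψ) = Sat G ρ σ φ × Sat G ρ σ ψ
Sat G ρ σ (ex₁ φ)    = ∃[ v ] Sat G (extend v ρ) σ φ
Sat G ρ σ (ex₂ φ)    = ∃[ P ] Sat G ρ (extend P σ) φ

Class : Set₁
Class = Graph → Set

-- MSO₁-orderable: φ(x,y; Z₁..Zₘ) (x = variable 0, y = variable 1)
MSO₁-orderable : Class → Set
MSO₁-orderable 𝒞 =
  Σ ℕ λ m → Σ (Formula 2 m) λ φ →
    ∀ G → 𝒞 G → 1 ≤ size (raw G) →
      Σ (Fin m → Subset (size (raw G))) λ P →
        IsTotalOrder _≡_
          (λ a b → Sat (raw G) (extend a (extend b (λ ()))) P φ)

record PGraph (k : ℕ) : Set where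
  field
    pg   : RawGraph
    port : Fin (size pg) → Fin k
open PGraph public

Rel₂ : ℕ → Set
Rel₂ k = Fin k → Fin k → Bool

-- x ∈ G, y ∈ H with ports a, b: edge iff (a,b) ∈ R (read symmetrically,
-- since edges are unordered)
_⊗[_]_ : ∀ {k} → PGraph k → Rel₂ k → PGraph k → PGraph k
_⊗[_]_ {k} G R H = record
  { pg   = record { size = size (pg G) + size (pg H)
                  ; adj  = pairAdj (adj (pg G)) (adj (pg H))
                             (λ x y → R (port G x) (port H y) ∨ R (port H y) (port G x)) }
  ; port = portJ }
  where
  portJ : Fin (size (pg G) + size (pg H)) → Fin k
  portJ z with splitAt (size (pg G)) z
  ... | inj₁ a = port G a
  ... | inj₂ b = port H b

emptyP : ∀ {k} → PGraph k
emptyP = record { pg = emptyG ; port = λ () }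

-- H₀ ⊗_R H₁ ⊗_R ⋯ ⊗_R H_{n-1}  (the operation is associative)
⊗R-all : ∀ {k n} → Rel₂ k → Vec (PGraph k) n → PGraph k
⊗R-all R []       = emptyP
⊗R-all R (H ∷ Hs) = H ⊗[ R ] ⊗R-all R Hs

Del : ∀ {k} → PGraph k → RawGraph
Del = pg

CutDecomp : Graph → ℕ → ℕ → Set
CutDecomp G k n =
  Σ (Rel₂ k) λ R → Σ (Vec (PGraph k) n) λ Hs →
    AllV (λ H → 1 ≤ size (pg H)) Hs × (raw G ≅ Del (⊗R-all R Hs))

-- Cut(G,k) ≤ f k  (Cut is the maximum such n)
HasCUT-f : (ℕ → ℕ) → Class → Set
HasCUT-f f 𝒞 = ∀ G → 𝒞 G → ∀ k n → CutDecomp G k n → n ≤ f k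

HasCUT : Class → Set
HasCUT 𝒞 = Σ (ℕ → ℕ) λ f → HasCUT-f f 𝒞

-- the cotree of every graph in 𝒞 has outdegree ≤ d
-- (the cotree is unique, so we quantify over all valid cotrees of G)
BoundedCotreeOutdeg : Class → Set
BoundedCotreeOutdeg 𝒞 =
  Σ ℕ λ d → ∀ G → 𝒞 G → ∀ T → ValidCotree T → raw G ≅ ⟦ T ⟧ → outdeg T ≤ d

{-# OPTIONS --safe #-}

-- (1) ⇒ (2), Feferman–Vaught: the truth of φ in H₀ ⊗_R ⋯ ⊗_R H_{n-1} is determined by the types
-- of the blocks, of which there are finitely many.  If there are more blocks than pairs of types,
-- two blocks i and j have chosen vertices of equal type, and exchanging these blocks turns φ(aᵢ, aⱼ)
-- into φ(aⱼ, aᵢ), which is impossible in a linear order.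
--
-- (2) ⇒ (3): the n children of a node of the cotree are the blocks of a cut with three ports, where
-- the vertices outside the node are put into the first block.
--
-- (3) ⇒ (1): order two vertices by comparing the children of their least common ancestor that
-- contain them.  That two vertices lie below the same child is first-order definable, so it suffices
-- to find parameters that distinguish siblings.  The statement "P contains a maximal clique of the
-- subtree" evaluates the subtree as an and-or formula (⊗ = and, ⊕ = or) on the leaf labels P.  With
-- 3d parameters the labels can be chosen top-down such that a subtree gets any prescribed value in
-- a code {0,1,2}^d while its at most d children get distinct ones.

module Submission where

open import Defs
open import Data.Bool using (Bool; true; false; _∨_)
import Data.Bool as Bool
open import Data.Bool.Properties using (∨-comm; ∨-idem)
open import Data.Fin using (Fin; zero; suc; splitAt; combine; remQuot; funToFin; finToFun; _≟_;
                            _↑ˡ_; _↑ʳ_)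
open import Data.Fin.Permutation.Components using (transpose; transpose-inverse)
open import Data.Fin.Properties
  using (combine-injective; remQuot-combine; finToFun-funToFin; pigeonhole; any?; <⇒≢; suc-injective;
         splitAt-↑ˡ; splitAt-↑ʳ; join-splitAt; ↑ˡ-injective; ↑ʳ-injective)
open import Data.Fin.Subset.Properties using (anySubset?)
open import Data.List using (List; []; _∷_; length; lookup; filter; allFin)
open import Data.List.Membership.Propositional.Properties
  using (∈-filter⁺; ∈-filter⁻; ∈-lookup; ∈-allFin)
open import Data.List.Relation.Unary.All using ([]; _∷_)
import Data.List.Relation.Unary.All as All
open import Data.List.Relation.Unary.AllPairs using (_∷_)
open import Data.List.Relation.Unary.Any using (index)
open import Data.List.Relation.Unary.Any.Properties using (lookup-index)
open import Data.List.Relation.Unary.Unique.Propositional using (Unique)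
import Data.List.Relation.Unary.Unique.Propositional.Properties as Unique
open import Data.Maybe using (Maybe; just; nothing)
open import Data.Maybe.Properties using (just-injective)
open import Data.Nat using (ℕ; zero; suc; _+_; _*_; _^_; _≤_; z≤n; s≤s)
open import Data.Nat.Properties
  using (≮⇒≥; ≤-trans; n≤1+n; ⊔-lub; m≤m⊔n; m≤n⊔m; m⊔n≤o⇒m≤o; m⊔n≤o⇒n≤o)
open import Data.Product using (Σ; ∃; ∃₂; ∃-syntax; _×_; _,_; proj₁; proj₂)
open import Data.Sum using (_⊎_; inj₁; inj₂; [_,_])
open import Data.Unit using (⊤; tt)
open import Data.Vec using (Vec; []; _∷_; tabulate)
import Data.Vec as Vec
open import Data.Vec.Properties using (lookup∘tabulate; tabulate∘lookup; tabulate-cong)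
open import Data.Vec.Relation.Unary.All.Properties using (lookup⁺; tabulate⁺)
open import Function using (_∘_; id)
open import Function.Bundles using (_↔_; _⇔_; Inverse; Injection; Equivalence; mk↔ₛ′; mk⇔)
open import Function.Properties.Inverse using (↔⇒↣; ↔-sym)
open import Relation.Binary.PropositionalEquality hiding ([_])
open import Relation.Binary.Structures using (IsTotalOrder)
open import Relation.Nullary using (¬_; Dec; yes; no; does; proof; contradiction)
open import Relation.Nullary.Decidable using (decidable-stable; map′; _×-dec_; ¬?; dec-true)
open import Relation.Nullary.Reflects using (Reflects; ofʸ; ofⁿ)

open Equivalence using () renaming (to to forth; from to back)

-- Composition of MSO-types

-- Replaces the nested sum `⊗R-all` by an indexed family in which no block has a special place, so
-- that blocks are easy to permute. The maps `from` allow any graph with such a partition, not only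
-- a literal join.
record Blocks (G : RawGraph) {k n} (R : Rel₂ k) (H : Fin n → PGraph k) : Set where
  field
    from      : ∀ l → Fin (size (pg (H l))) → Fin (size G)
    cover     : ∀ x → ∃₂ λ l u → from l u ≡ x
    injective : ∀ {l m u v} → from l u ≡ from m v → (l , u) ≡ (m , v)
    within    : ∀ l u v → adj G (from l u) (from l v) ≡ adj (pg (H l)) u v
    across    : ∀ {l m} u v → l ≢ m →
                adj G (from l u) (from m v) ≡
                  R (port (H l) u) (port (H m) v) ∨ R (port (H m) v) (port (H l) u)

  from-injective : ∀ {l u v} → from l u ≡ from l v → u ≡ v
  from-injective e with injective e
  ... | refl = refl

  at : ∀ l → Fin (size G) → Maybe (Fin (size (pg (H l))))
  at l x with cover x
  ... | m , u , _ with m ≟ l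
  ...   | yes refl = just u
  ...   | no _     = nothing

  at-from : ∀ l u → at l (from l u) ≡ just u
  at-from l u with cover (from l u)
  ... | m , v , e with injective e
  ...   | refl with l ≟ l
  ...     | yes refl = refl
  ...     | no l≢l   = contradiction refl l≢l

  at-other : ∀ {l m} u → l ≢ m → at m (from l u) ≡ nothing
  at-other {l} {m} u l≢m with cover (from l u)
  ... | _ , _ , e with injective e
  ...   | refl with l ≟ m
  ...     | yes l≡m = contradiction l≡m l≢m
  ...     | no _    = refl

  at-just : ∀ {l x u} → at l x ≡ just u → from l u ≡ x
  at-just {l} {x} e with cover x
  ... | m , v , from≡x with m ≟ l
  at-just refl | m , v , from≡x | yes refl = from≡x
  at-just ()   | m , v , from≡x | no _

  points : ∀ {i} l → (Fin i → Fin (size G)) → Vec (Maybe (Fin (size (pg (H l))))) i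
  points l ρ = tabulate (at l ∘ ρ)

  part : ∀ l → Subset (size G) → Vec Bool (size (pg (H l)))
  part l P = tabulate (P ∘ from l)

  parts : ∀ {j} l → (Fin j → Subset (size G)) → Vec (Vec Bool (size (pg (H l)))) j
  parts l σ = tabulate (part l ∘ σ)

  points-from : ∀ {i l u} (ρ : Fin i → Fin (size G)) z → from l u ≡ ρ z →
                Vec.lookup (points l ρ) z ≡ just u
  points-from {l = l} {u} ρ z e = begin
    Vec.lookup (points l ρ) z  ≡⟨ lookup∘tabulate (at l ∘ ρ) z ⟩
    at l (ρ z)             ≡⟨ cong (at l) (sym e) ⟩
    at l (from l u)        ≡⟨ at-from l u ⟩
    just u                 ∎
    where open ≡-Reasoning

  points-just : ∀ {i l u} (ρ : Fin i → Fin (size G)) z →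
                Vec.lookup (points l ρ) z ≡ just u → from l u ≡ ρ z
  points-just ρ z e = at-just (trans (sym (lookup∘tabulate _ z)) e)

  lookup-parts : ∀ {j} l (σ : Fin j → Subset (size G)) X u →
                 Vec.lookup (Vec.lookup (parts l σ) X) u ≡ σ X (from l u)
  lookup-parts l σ X u = begin
    Vec.lookup (Vec.lookup (parts l σ) X) u  ≡⟨ cong (λ P → Vec.lookup P u) (lookup∘tabulate (part l ∘ σ) X) ⟩
    Vec.lookup (part l (σ X)) u          ≡⟨ lookup∘tabulate (σ X ∘ from l) u ⟩
    σ X (from l u)                   ∎
    where open ≡-Reasoning

  glue : (∀ l → Vec Bool (size (pg (H l)))) → Subset (size G)
  glue Q x with cover x
  ... | l , u , _ = Vec.lookup (Q l) u

  part-glue : ∀ Q l → part l (glue Q) ≡ Q l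
  part-glue Q l = trans (tabulate-cong glue-from) (tabulate∘lookup (Q l))
    where
    glue-from : ∀ u → glue Q (from l u) ≡ Vec.lookup (Q l) u
    glue-from u with cover (from l u)
    ... | _ , _ , e with injective e
    ...   | refl = refl

-- Commutativity of the join: the rule for edges between blocks is the same for every pair of
-- indices, so all fields carry over along a permutation `π`.
reindex : ∀ {G k n} {R : Rel₂ k} {H : Fin n → PGraph k} → Blocks G R H →
          (π : Fin n → Fin n) → (∀ l m → π l ≡ π m → l ≡ m) → (∀ l → ∃[ m ] π m ≡ l) →
          Blocks G R (H ∘ π)
reindex {G} {H = H} B π π-inj π-surj = record
  { from      = λ l → from (π l)
  ; cover     = cover′
  ; injective = injective′
  ; within    = λ l → within (π l)
  ; across    = λ u v l≢m → across u v (l≢m ∘ π-inj _ _)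
  }
  where
  open Blocks B
  cover′ : ∀ x → ∃₂ λ l u → from (π l) u ≡ x
  cover′ x with cover x
  ... | l , u , e with π-surj l
  ...   | m , refl = m , u , e
  injective′ : ∀ {l m u v} → from (π l) u ≡ from (π m) v → (l , u) ≡ (m , v)
  injective′ {l} {m} e with injective e
  ... | e′ with π-inj l m (cong proj₁ e′)
  injective′ e | refl | refl = refl

bit : Bool → Fin 2
bit false = zero
bit true  = suc zero

bit-injective : ∀ {a b} → bit a ≡ bit b → a ≡ b
bit-injective {false} {false} _ = refl
bit-injective {true}  {true}  _ = refl

subsetCode : ∀ {n} → (Fin n → Bool) → Fin (2 ^ n)
subsetCode f = funToFin (bit ∘ f)

subsetCode-injective : ∀ {n} (f g : Fin n → Bool) → subsetCode f ≡ subsetCode g → f ≗ g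
subsetCode-injective f g e c = bit-injective (begin
  bit (f c)                        ≡⟨ finToFun-funToFin (bit ∘ f) c ⟨
  finToFun (funToFin (bit ∘ f)) c  ≡⟨ cong (λ z → finToFun z c) e ⟩
  finToFun (funToFin (bit ∘ g)) c  ≡⟨ finToFun-funToFin (bit ∘ g) c ⟩
  bit (g c)                        ∎)
  where open ≡-Reasoning

does-transfer : ∀ {A B : Set} (A? : Dec A) (B? : Dec B) → does A? ≡ does B? → A → B
does-transfer (yes _) (yes b) _  _ = b
does-transfer (yes _) (no _)  () _
does-transfer (no ¬a) _       _  a = contradiction a ¬a

-- Depends on the number of ports and the formula but not on the size of a block, which makes the
-- pigeonhole argument uniform in the graph. `suc k` leaves room for the port of an absent vertex.
#types : ℕ → ∀ {i j} → Formula i j → ℕ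
#types k (eq x y)   = 2
#types k (edg x y)  = (suc k * suc k) * 2
#types k (mem x X)  = 2
#types k (neg φ)    = #types k φ
#types k (conj φ ψ) = #types k φ * #types k ψ
#types k (ex₁ φ)    = #types k φ * 2 ^ #types k φ
#types k (ex₂ φ)    = 2 ^ #types k φ

module _ {k : ℕ} (H : PGraph k) where

  private
    V : Set
    V = Fin (size (pg H))

  -- The default is `false` here and in `adjᵐ` and `memᵐ`, so that the value `true` certifies that
  -- the variables lie in this block.
  sameᵐ : Maybe V → Maybe V → Bool
  sameᵐ (just u) (just v) = does (u ≟ v)
  sameᵐ _        _        = false

  adjᵐ : Maybe V → Maybe V → Bool
  adjᵐ (just u) (just v) = adj (pg H) u v
  adjᵐ _        _        = false

  memᵐ : Maybe V → Vec Bool (size (pg H)) → Bool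
  memᵐ (just u) P = Vec.lookup P u
  memᵐ nothing  _ = false

  portᵐ : Maybe V → Fin (suc k)
  portᵐ (just u) = suc (port H u)
  portᵐ nothing  = zero

  -- The truth of φ in a composition depends only on the types of the blocks.  A point variable is
  -- nothing when its value lies in another block, so ex₁ also records the type with nothing added.
  type : ∀ {i j} → Vec (Maybe V) i → Vec (Vec Bool (size (pg H))) j →
         (φ : Formula i j) → Fin (#types k φ)
  type ρ σ (eq x y)   = bit (sameᵐ (Vec.lookup ρ x) (Vec.lookup ρ y))
  type ρ σ (edg x y)  = combine (combine (portᵐ (Vec.lookup ρ x)) (portᵐ (Vec.lookup ρ y)))
                                (bit (adjᵐ (Vec.lookup ρ x) (Vec.lookup ρ y)))
  type ρ σ (mem x X)  = bit (memᵐ (Vec.lookup ρ x) (Vec.lookup σ X))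
  type ρ σ (neg φ)    = type ρ σ φ
  type ρ σ (conj φ ψ) = combine (type ρ σ φ) (type ρ σ ψ)
  type ρ σ (ex₁ φ)    = combine (type (nothing ∷ ρ) σ φ)
                          (subsetCode λ c → does (any? λ v → type (just v ∷ ρ) σ φ ≟ c))
  type ρ σ (ex₂ φ)    = subsetCode λ c → does (anySubset? λ P → type ρ (P ∷ σ) φ ≟ c)

module _ {k : ℕ} {H H′ : PGraph k} where

  sameᵐ-transfer : ∀ {m n m′ n′ u} → sameᵐ H m n ≡ sameᵐ H′ m′ n′ → m ≡ just u → n ≡ just u →
                   ∃[ u′ ] (m′ ≡ just u′ × n′ ≡ just u′)
  sameᵐ-transfer {m′ = m′} {n′} {u} e refl refl with u ≟ u
  ... | no u≢u = contradiction refl u≢u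
  ... | yes _ with m′ | n′
  ...   | nothing | _       = contradiction e λ ()
  ...   | just _  | nothing = contradiction e λ ()
  ...   | just v  | just w with v ≟ w
  ...     | yes refl = v , refl , refl
  ...     | no _     = contradiction e λ ()

  adjᵐ-transfer : ∀ {m n m′ n′ u v} → adjᵐ H m n ≡ adjᵐ H′ m′ n′ → m ≡ just u → n ≡ just v →
                  adj (pg H) u v ≡ true →
                  ∃₂ λ u′ v′ → m′ ≡ just u′ × n′ ≡ just v′ × adj (pg H′) u′ v′ ≡ true
  adjᵐ-transfer {m′ = just u} {just v} e refl refl t = u , v , refl , refl , trans (sym e) t
  adjᵐ-transfer {m′ = just _} {nothing} e refl refl t = contradiction (trans (sym e) t) λ ()
  adjᵐ-transfer {m′ = nothing} e refl refl t = contradiction (trans (sym e) t) λ ()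

  memᵐ-transfer : ∀ {m m′ P P′ u} → memᵐ H m P ≡ memᵐ H′ m′ P′ → m ≡ just u →
                  Vec.lookup P u ≡ true → ∃[ u′ ] (m′ ≡ just u′ × Vec.lookup P′ u′ ≡ true)
  memᵐ-transfer {m′ = just u} e refl t = u , refl , trans (sym e) t
  memᵐ-transfer {m′ = nothing} e refl t = contradiction (trans (sym e) t) λ ()

  portᵐ-transfer : ∀ {m m′ u} → portᵐ H m ≡ portᵐ H′ m′ → m ≡ just u →
                   ∃[ u′ ] (m′ ≡ just u′ × port H u ≡ port H′ u′)
  portᵐ-transfer {m′ = just u} e refl = u , refl , suc-injective e

module _ {k : ℕ} {H H′ : PGraph k} {i j : ℕ}
         {ρ : Vec (Maybe (Fin (size (pg H)))) i} {σ : Vec (Vec Bool (size (pg H))) j}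
         {ρ′ : Vec (Maybe (Fin (size (pg H′)))) i} {σ′ : Vec (Vec Bool (size (pg H′))) j} where

  edg-transfer : ∀ (x y : Fin i) → type H ρ σ (edg x y) ≡ type H′ ρ′ σ′ (edg x y) →
    (portᵐ H (Vec.lookup ρ x) ≡ portᵐ H′ (Vec.lookup ρ′ x) ×
     portᵐ H (Vec.lookup ρ y) ≡ portᵐ H′ (Vec.lookup ρ′ y)) ×
    adjᵐ H (Vec.lookup ρ x) (Vec.lookup ρ y) ≡ adjᵐ H′ (Vec.lookup ρ′ x) (Vec.lookup ρ′ y)
  edg-transfer x y e =
    let px   = portᵐ H (Vec.lookup ρ x)
        py   = portᵐ H (Vec.lookup ρ y)
        px′  = portᵐ H′ (Vec.lookup ρ′ x)
        py′  = portᵐ H′ (Vec.lookup ρ′ y)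
        ports , adjs = combine-injective (combine px py) (bit (adjᵐ H (Vec.lookup ρ x) (Vec.lookup ρ y)))
                         (combine px′ py′) (bit (adjᵐ H′ (Vec.lookup ρ′ x) (Vec.lookup ρ′ y))) e
    in combine-injective px py px′ py′ ports , bit-injective adjs

  conj-transfer : ∀ (φ ψ : Formula i j) → type H ρ σ (conj φ ψ) ≡ type H′ ρ′ σ′ (conj φ ψ) →
    type H ρ σ φ ≡ type H′ ρ′ σ′ φ × type H ρ σ ψ ≡ type H′ ρ′ σ′ ψ
  conj-transfer φ ψ = combine-injective (type H ρ σ φ) (type H ρ σ ψ) (type H′ ρ′ σ′ φ) (type H′ ρ′ σ′ ψ)

  ex₁-transfer : ∀ (φ : Formula (suc i) j) → type H ρ σ (ex₁ φ) ≡ type H′ ρ′ σ′ (ex₁ φ) →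
    type H (nothing ∷ ρ) σ φ ≡ type H′ (nothing ∷ ρ′) σ′ φ ×
    (∀ u → ∃[ u′ ] type H′ (just u′ ∷ ρ′) σ′ φ ≡ type H (just u ∷ ρ) σ φ)
  ex₁-transfer φ e =
    let e₀ , e₁ = combine-injective (type H (nothing ∷ ρ) σ φ) (subsetCode (does ∘ extends))
                                    (type H′ (nothing ∷ ρ′) σ′ φ) (subsetCode (does ∘ extends′)) e
    in e₀ , λ u → let c = type H (just u ∷ ρ) σ φ in
      does-transfer (extends c) (extends′ c)
        (subsetCode-injective (does ∘ extends) (does ∘ extends′) e₁ c) (u , refl)
    where
    extends : ∀ c → Dec (∃[ u ] type H (just u ∷ ρ) σ φ ≡ c)
    extends c = any? λ u → type H (just u ∷ ρ) σ φ ≟ c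
    extends′ : ∀ c → Dec (∃[ u ] type H′ (just u ∷ ρ′) σ′ φ ≡ c)
    extends′ c = any? λ u → type H′ (just u ∷ ρ′) σ′ φ ≟ c

  ex₂-transfer : ∀ (φ : Formula i (suc j)) → type H ρ σ (ex₂ φ) ≡ type H′ ρ′ σ′ (ex₂ φ) →
    ∀ P → ∃[ P′ ] type H′ ρ′ (P′ ∷ σ′) φ ≡ type H ρ (P ∷ σ) φ
  ex₂-transfer φ e P =
    does-transfer (extends c) (extends′ c)
      (subsetCode-injective (does ∘ extends) (does ∘ extends′) e c) (P , refl)
    where
    c : Fin (#types k φ)
    c = type H ρ (P ∷ σ) φ
    extends : ∀ c → Dec (∃[ P ] type H ρ (P ∷ σ) φ ≡ c)
    extends c = anySubset? λ P → type H ρ (P ∷ σ) φ ≟ c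
    extends′ : ∀ c → Dec (∃[ P ] type H′ ρ′ (P ∷ σ′) φ ≡ c)
    extends′ c = anySubset? λ P → type H′ ρ′ (P ∷ σ′) φ ≟ c

module _ {k n : ℕ} {R : Rel₂ k} where

  open Blocks

  -- Induction on the formula. One implication suffices, because the hypothesis is symmetric and
  -- `neg` exchanges the two compositions.
  Sat-compose : ∀ {G G′} {H H′ : Fin n → PGraph k} (B : Blocks G R H) (B′ : Blocks G′ R H′)
    {i j} (φ : Formula i j) {ρ σ ρ′ σ′} →
    (∀ l → type (H l) (points B l ρ) (parts B l σ) φ ≡
           type (H′ l) (points B′ l ρ′) (parts B′ l σ′) φ) →
    Sat G ρ σ φ → Sat G′ ρ′ σ′ φ
  Sat-compose {H = H} {H′} B B′ (eq x y) {ρ} {ρ′ = ρ′} same ρx≡ρy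
    -- Only the block containing `ρ x` is consulted: its type records that both variables denote the
    -- same vertex there.
    with cover B (ρ x)
  ... | l , u , e
    with sameᵐ-transfer {H = H l} {H′ l} (bit-injective (same l))
           (points-from B ρ x e) (points-from B ρ y (trans e ρx≡ρy))
  ... | u′ , px , py = trans (sym (points-just B′ ρ′ x px)) (points-just B′ ρ′ y py)
  Sat-compose {G} {G′} {H} {H′} B B′ (edg x y) {ρ} {σ} {ρ′} {σ′} same edge
    with cover B (ρ x) | cover B (ρ y)
  ... | l , u , e | m , v , f with l ≟ m
  ... | yes refl
    with adjᵐ-transfer {H = H l} {H′ l} (proj₂ (edges l)) (points-from B ρ x e) (points-from B ρ y f)
           (trans (sym (within B l u v)) (trans (cong₂ (adj G) e f) edge))
    where
    edges = λ l → edg-transfer {H = H l} {H′ l} {ρ = points B l ρ} {parts B l σ}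
                               {points B′ l ρ′} {parts B′ l σ′} x y (same l)
  ... | u′ , v′ , px , py , t =
    trans (sym (cong₂ (adj G′) (points-just B′ ρ′ x px) (points-just B′ ρ′ y py)))
          (trans (within B′ l u′ v′) t)
  -- The ends lie in distinct blocks, so the edge depends only on their ports, and each port is read
  -- from the type of its own block.
  Sat-compose {G} {G′} {H} {H′} B B′ (edg x y) {ρ} {σ} {ρ′} {σ′} same edge
      | l , u , e | m , v , f | no l≢m
    with portᵐ-transfer {H = H l} {H′ l} (proj₁ (proj₁ (edges l))) (points-from B ρ x e)
       | portᵐ-transfer {H = H m} {H′ m} (proj₂ (proj₁ (edges m))) (points-from B ρ y f)
    where
    edges = λ l → edg-transfer {H = H l} {H′ l} {ρ = points B l ρ} {parts B l σ}
                               {points B′ l ρ′} {parts B′ l σ′} x y (same l)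
  ... | u′ , px , pu | v′ , py , pv = begin
    adj G′ (ρ′ x) (ρ′ y)
      ≡⟨ cong₂ (adj G′) (points-just B′ ρ′ x px) (points-just B′ ρ′ y py) ⟨
    adj G′ (from B′ l u′) (from B′ m v′)
      ≡⟨ across B′ u′ v′ l≢m ⟩
    R (port (H′ l) u′) (port (H′ m) v′) ∨ R (port (H′ m) v′) (port (H′ l) u′)
      ≡⟨ cong₂ (λ p q → R p q ∨ R q p) pu pv ⟨
    R (port (H l) u) (port (H m) v) ∨ R (port (H m) v) (port (H l) u)
      ≡⟨ across B u v l≢m ⟨
    adj G (from B l u) (from B m v)
      ≡⟨ cong₂ (adj G) e f ⟩
    adj G (ρ x) (ρ y)
      ≡⟨ edge ⟩
    true ∎
    where open ≡-Reasoning
  Sat-compose {H = H} {H′} B B′ (mem x X) {ρ} {σ} {ρ′} {σ′} same in-X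
    with cover B (ρ x)
  ... | l , u , e
    with memᵐ-transfer {H = H l} {H′ l} (bit-injective (same l)) (points-from B ρ x e)
           (trans (lookup-parts B l σ X u) (trans (cong (σ X) e) in-X))
  ... | u′ , px , t = begin
    σ′ X (ρ′ x)                               ≡⟨ cong (σ′ X) (points-just B′ ρ′ x px) ⟨
    σ′ X (from B′ l u′)                       ≡⟨ lookup-parts B′ l σ′ X u′ ⟨
    Vec.lookup (Vec.lookup (parts B′ l σ′) X) u′  ≡⟨ t ⟩
    true                                      ∎
    where open ≡-Reasoning
  Sat-compose B B′ (neg φ) same ¬φ φ′ = ¬φ (Sat-compose B′ B φ (sym ∘ same) φ′)
  Sat-compose {H = H} {H′} B B′ (conj φ ψ) {ρ} {σ} {ρ′} {σ′} same (p , q) =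
    Sat-compose B B′ φ (proj₁ ∘ both) p , Sat-compose B B′ ψ (proj₂ ∘ both) q
    where
    both = λ l → conj-transfer {H = H l} {H′ l} {ρ = points B l ρ} {parts B l σ}
                               {points B′ l ρ′} {parts B′ l σ′} φ ψ (same l)
  Sat-compose {G} {H = H} {H′} B B′ (ex₁ φ) {ρ} {σ} {ρ′} {σ′} same (x , p) =
    -- The witness is replaced inside its own block `l`. Every other block sees the new variable as
    -- `nothing`, and for it the first component of the `ex₁` type is used.
    let l , u , e = cover B x
        u′ , e′   = proj₂ (extensions l) u
    in from B′ l u′ , Sat-compose B B′ φ (same′ l u u′ e′)
                        (subst (λ x → Sat G (extend x ρ) σ φ) (sym e) p)
    where
    extensions : ∀ l →
      type (H l) (nothing ∷ points B l ρ) (parts B l σ) φ ≡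
        type (H′ l) (nothing ∷ points B′ l ρ′) (parts B′ l σ′) φ ×
      (∀ u → ∃[ u′ ] type (H′ l) (just u′ ∷ points B′ l ρ′) (parts B′ l σ′) φ ≡
                     type (H l) (just u ∷ points B l ρ) (parts B l σ) φ)
    extensions l = ex₁-transfer {H = H l} {H′ l} {ρ = points B l ρ} {parts B l σ}
                                {points B′ l ρ′} {parts B′ l σ′} φ (same l)
    same′ : ∀ l u u′ →
      type (H′ l) (just u′ ∷ points B′ l ρ′) (parts B′ l σ′) φ ≡
        type (H l) (just u ∷ points B l ρ) (parts B l σ) φ →
      ∀ m → type (H m) (at B m (from B l u) ∷ points B m ρ) (parts B m σ) φ ≡
            type (H′ m) (at B′ m (from B′ l u′) ∷ points B′ m ρ′) (parts B′ m σ′) φ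
    same′ l u u′ e m with l ≟ m
    ... | yes refl rewrite at-from B l u | at-from B′ l u′ = sym e
    ... | no l≢m rewrite at-other B u l≢m | at-other B′ u′ l≢m = proj₁ (extensions m)
  Sat-compose {G′ = G′} {H} {H′} B B′ (ex₂ φ) {ρ} {σ} {ρ′} {σ′} same (P , p) =
    -- A set can be chosen independently in every block, so replacements are found blockwise and
    -- then united.
    glue B′ (proj₁ ∘ Q) , Sat-compose B B′ φ same′ p
    where
    Q : ∀ l → ∃[ Q ] type (H′ l) (points B′ l ρ′) (Q ∷ parts B′ l σ′) φ ≡
                     type (H l) (points B l ρ) (part B l P ∷ parts B l σ) φ
    Q l = ex₂-transfer {H = H l} {H′ l} {ρ = points B l ρ} {parts B l σ}
                       {points B′ l ρ′} {parts B′ l σ′} φ (same l) (part B l P)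
    same′ : ∀ l → type (H l) (points B l ρ) (part B l P ∷ parts B l σ) φ ≡
                  type (H′ l) (points B′ l ρ′) (part B′ l (glue B′ (proj₁ ∘ Q)) ∷ parts B′ l σ′) φ
    same′ l = trans (sym (proj₂ (Q l)))
      (cong (λ P′ → type (H′ l) (points B′ l ρ′) (P′ ∷ parts B′ l σ′) φ) (sym (part-glue B′ (proj₁ ∘ Q) l)))

-- Exchanging two blocks in an ordered graph

transpose-injective : ∀ {n} (i j l m : Fin n) → transpose i j l ≡ transpose i j m → l ≡ m
transpose-injective i j l m e = begin
  l                                    ≡⟨ transpose-inverse j i ⟨
  transpose j i (transpose i j l)      ≡⟨ cong (transpose j i) e ⟩
  transpose j i (transpose i j m)      ≡⟨ transpose-inverse j i ⟩
  m                                    ∎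
  where open ≡-Reasoning

pair : ∀ {A : Set} → A → A → Fin 2 → A
pair a b = extend a (extend b λ ())

module _ {G : RawGraph} {k n} {R : Rel₂ k} {H : Fin n → PGraph k} (B : Blocks G R H) where

  open Blocks B

  at-reindex : ∀ π π-inj π-surj l x →
               Blocks.at (reindex B π π-inj π-surj) l x ≡ at (π l) x
  at-reindex π π-inj π-surj l x =
    let m , u , e = Blocks.cover B′ x in subst (λ y → Blocks.at B′ l y ≡ at (π l) y) e (on-block m u)
    where
    B′ = reindex B π π-inj π-surj
    on-block : ∀ m u → Blocks.at B′ l (from (π m) u) ≡ at (π l) (from (π m) u)
    on-block m u with m ≟ l
    ... | yes refl = trans (Blocks.at-from B′ m u) (sym (at-from (π m) u))
    ... | no m≢l   = trans (Blocks.at-other B′ u m≢l) (sym (at-other u (m≢l ∘ π-inj m l)))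

  module _ {m : ℕ} (φ : Formula 2 m) (σ : Fin m → Subset (size G))
           (p : ∀ l → Fin (size (pg (H l)))) where

    a : Fin n → Fin (size G)
    a l = from l (p l)

    typeOf : ∀ l → Maybe (Fin (size (pg (H l)))) → Maybe (Fin (size (pg (H l)))) → Fin (#types k φ)
    typeOf l x y = type (H l) (x ∷ y ∷ []) (parts l σ) φ

    -- After the exchange, position `i` holds block `j` with its chosen vertex again in the first
    -- role, and position `j` holds block `i` with its vertex in the second role. The two hypotheses
    -- make the types at these positions agree; at any other position the block stays and both
    -- variables are absent.
    Sat-swap : ∀ {i j} → i ≢ j →
               typeOf i (just (p i)) nothing ≡ typeOf j (just (p j)) nothing →
               typeOf i nothing (just (p i)) ≡ typeOf j nothing (just (p j)) →
               Sat G (pair (a i) (a j)) σ φ → Sat G (pair (a j) (a i)) σ φ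
    Sat-swap {i} {j} i≢j first second = Sat-compose B B′ φ same
      where
      π : Fin n → Fin n
      π = transpose i j
      surjective : ∀ l → ∃[ m ] π m ≡ l
      surjective l = transpose j i l , transpose-inverse i j
      B′ : Blocks G R (H ∘ π)
      B′ = reindex B π (transpose-injective i j) surjective
      swapped : Fin n → Fin (#types k φ)
      swapped l = typeOf l (at l (a j)) (at l (a i))
      unswap : ∀ l → typeOf l (at l (a i)) (at l (a j)) ≡ swapped (π l)
      unswap l with l ≟ i
      ... | yes refl = begin
        typeOf i (at i (a i)) (at i (a j))  ≡⟨ cong₂ (typeOf i) (at-from i _) (at-other _ (i≢j ∘ sym)) ⟩
        typeOf i (just (p i)) nothing       ≡⟨ first ⟩
        typeOf j (just (p j)) nothing       ≡⟨ cong₂ (typeOf j) (at-from j _) (at-other _ i≢j) ⟨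
        swapped j ∎
        where open ≡-Reasoning
      ... | no l≢i with l ≟ j
      ...   | yes refl = begin
        typeOf j (at j (a i)) (at j (a j))  ≡⟨ cong₂ (typeOf j) (at-other _ i≢j) (at-from j _) ⟩
        typeOf j nothing (just (p j))       ≡⟨ second ⟨
        typeOf i nothing (just (p i))       ≡⟨ cong₂ (typeOf i) (at-other _ (i≢j ∘ sym)) (at-from i _) ⟨
        swapped i ∎
        where open ≡-Reasoning
      ...   | no l≢j = begin
        typeOf l (at l (a i)) (at l (a j))  ≡⟨ cong₂ (typeOf l) (at-other _ (l≢i ∘ sym))
                                                                   (at-other _ (l≢j ∘ sym)) ⟩
        typeOf l nothing nothing            ≡⟨ cong₂ (typeOf l) (at-other _ (l≢j ∘ sym))
                                                                   (at-other _ (l≢i ∘ sym)) ⟨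
        swapped l ∎
        where open ≡-Reasoning
      same : ∀ l → typeOf l (at l (a i)) (at l (a j)) ≡
                   type (H (π l)) (Blocks.points B′ l (pair (a j) (a i))) (Blocks.parts B′ l σ) φ
      same l = trans (unswap l)
        (sym (cong₂ (typeOf (π l)) (at-reindex π (transpose-injective i j) surjective l (a j))
                                   (at-reindex π (transpose-injective i j) surjective l (a i))))

    ordered⇒few-blocks : IsTotalOrder _≡_ (λ x y → Sat G (pair x y) σ φ) →
                         n ≤ #types k φ * #types k φ
    ordered⇒few-blocks order = ≮⇒≥ λ few →
      -- A block is coloured by the types of its chosen vertex in both roles, since `Sat-swap` needs
      -- both to agree.
      let i , j , i<j , e = pigeonhole few λ l →
            combine (typeOf l (just (p l)) nothing) (typeOf l nothing (just (p l)))
          e₁ , e₂ = combine-injective _ _ _ _ e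
      in absurd (<⇒≢ i<j) e₁ e₂ (IsTotalOrder.total order (a i) (a j))
      where
      absurd : ∀ {i j} → i ≢ j →
               typeOf i (just (p i)) nothing ≡ typeOf j (just (p j)) nothing →
               typeOf i nothing (just (p i)) ≡ typeOf j nothing (just (p j)) →
               ¬ (Sat G (pair (a i) (a j)) σ φ ⊎ Sat G (pair (a j) (a i)) σ φ)
      absurd i≢j e₁ e₂ (inj₁ s) = i≢j (cong proj₁ (injective
        (IsTotalOrder.antisym order s (Sat-swap i≢j e₁ e₂ s))))
      absurd i≢j e₁ e₂ (inj₂ s) = i≢j (cong proj₁ (injective
        (IsTotalOrder.antisym order (Sat-swap (i≢j ∘ sym) (sym e₁) (sym e₂) s) s)))

-- Joins as block decompositions

open Blocks

Blocks-iso : ∀ {G G′ k n} {R : Rel₂ k} {H : Fin n → PGraph k} → G ≅ G′ → Blocks G′ R H → Blocks G R H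
Blocks-iso {G} {G′} (f , f-adj) B = record
  { from      = λ l u → g (from B l u)
  ; cover     = λ x → let l , u , e = cover B (to f x) in l , u , trans (cong g e) (strictlyInverseʳ f x)
  ; injective = λ e → injective B (Injection.injective (↔⇒↣ (↔-sym f)) e)
  ; within    = λ l u v → trans (adj-g _ _) (within B l u v)
  ; across    = λ u v l≢m → trans (adj-g _ _) (across B u v l≢m)
  }
  where
  open Inverse using (to; strictlyInverseˡ; strictlyInverseʳ)
  g = Inverse.from f
  adj-g : ∀ x y → adj G (g x) (g y) ≡ adj G′ x y
  adj-g x y = trans (f-adj (g x) (g y)) (cong₂ (adj G′) (strictlyInverseˡ f x) (strictlyInverseˡ f y))

module _ {n m : ℕ} (aG : Fin n → Fin n → Bool) (aH : Fin m → Fin m → Bool)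
         (cross : Fin n → Fin m → Bool) where

  pairAdj-left : ∀ u v → pairAdj aG aH cross (u ↑ˡ m) (v ↑ˡ m) ≡ aG u v
  pairAdj-left u v rewrite splitAt-↑ˡ n u m | splitAt-↑ˡ n v m = refl

  pairAdj-right : ∀ u v → pairAdj aG aH cross (n ↑ʳ u) (n ↑ʳ v) ≡ aH u v
  pairAdj-right u v rewrite splitAt-↑ʳ n m u | splitAt-↑ʳ n m v = refl

  pairAdj-left-right : ∀ u v → pairAdj aG aH cross (u ↑ˡ m) (n ↑ʳ v) ≡ cross u v
  pairAdj-left-right u v rewrite splitAt-↑ˡ n u m | splitAt-↑ʳ n m v = refl

  pairAdj-right-left : ∀ u v → pairAdj aG aH cross (n ↑ʳ u) (v ↑ˡ m) ≡ cross v u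
  pairAdj-right-left u v rewrite splitAt-↑ʳ n m u | splitAt-↑ˡ n v m = refl

↑ˡ≢↑ʳ : ∀ {n m} (u : Fin n) (v : Fin m) → u ↑ˡ m ≢ n ↑ʳ v
↑ˡ≢↑ʳ {n} {m} u v e =
  contradiction (trans (sym (splitAt-↑ˡ n u m)) (trans (cong (splitAt n) e) (splitAt-↑ʳ n m v))) λ ()

-- `cross` is left abstract so that the same construction serves joins with ports and the nodes of a
-- cotree.
Blocks-∷ : ∀ {k n G′} {R : Rel₂ k} (H : Fin (suc n) → PGraph k) (B : Blocks G′ R (H ∘ suc)) →
           ∀ cross →
           (∀ u l v → cross u (from B l v) ≡
                      R (port (H zero) u) (port (H (suc l)) v) ∨ R (port (H (suc l)) v) (port (H zero) u)) →
           Blocks (record { size = size (pg (H zero)) + size G′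
                          ; adj  = pairAdj (adj (pg (H zero))) (adj G′) cross }) R H
Blocks-∷ {k} {n} {G′} {R} H B cross crossing = record
  { from      = from′
  ; cover     = cover′
  ; injective = λ {l} {m} {u} {v} → injective′ l m u v
  ; within    = within′
  ; across    = λ {l} {m} → across′ l m
  }
  where
  s₀ = size (pg (H zero))
  from′ : ∀ l → Fin (size (pg (H l))) → Fin (s₀ + size G′)
  from′ zero    u = u ↑ˡ size G′
  from′ (suc l) u = s₀ ↑ʳ from B l u
  cover′ : ∀ x → ∃₂ λ l u → from′ l u ≡ x
  cover′ x with splitAt s₀ x | join-splitAt s₀ (size G′) x
  ... | inj₁ u | refl = zero , u , refl
  ... | inj₂ y | refl with cover B y
  ...   | l , u , refl = suc l , u , refl
  injective′ : ∀ l m u v → from′ l u ≡ from′ m v → (l , u) ≡ (m , v)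
  injective′ zero    zero    u v e = cong (zero ,_) (↑ˡ-injective _ _ _ e)
  injective′ zero    (suc m) u v e = contradiction e (↑ˡ≢↑ʳ u _)
  injective′ (suc l) zero    u v e = contradiction (sym e) (↑ˡ≢↑ʳ v _)
  injective′ (suc l) (suc m) u v e with injective B (↑ʳ-injective s₀ _ _ e)
  ... | refl = refl
  adj′ = pairAdj (adj (pg (H zero))) (adj G′) cross
  within′ : ∀ l u v → adj′ (from′ l u) (from′ l v) ≡ adj (pg (H l)) u v
  within′ zero    u v = pairAdj-left _ _ cross u v
  within′ (suc l) u v = trans (pairAdj-right _ _ cross _ _) (within B l u v)
  across′ : ∀ l m u v → l ≢ m → adj′ (from′ l u) (from′ m v) ≡
            R (port (H l) u) (port (H m) v) ∨ R (port (H m) v) (port (H l) u)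
  across′ zero    zero    u v l≢m = contradiction refl l≢m
  across′ zero    (suc m) u v l≢m = trans (pairAdj-left-right _ _ cross _ _) (crossing u m v)
  across′ (suc l) zero    u v l≢m =
    trans (pairAdj-right-left _ _ cross _ _)
          (trans (crossing v l u) (∨-comm (R (port (H zero) v) (port (H (suc l)) u)) _))
  across′ (suc l) (suc m) u v l≢m =
    trans (pairAdj-right _ _ cross _ _) (across B u v (l≢m ∘ cong suc))

mutual

  ⊗R-blocks : ∀ {k n} (R : Rel₂ k) (H : Fin n → PGraph k) → Blocks (pg (⊗R-all R (tabulate H))) R H
  ⊗R-blocks {n = zero} R H = record
    { from = λ () ; cover = λ () ; injective = λ { {()} } ; within = λ () ; across = λ { {()} } }
  ⊗R-blocks {n = suc n} R H = Blocks-∷ H (⊗R-blocks R (H ∘ suc)) _ λ u l v →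
    cong (λ p → R (port (H zero) u) p ∨ R p (port (H zero) u)) (⊗R-port R (H ∘ suc) l v)

  -- The edges from the first block to the rest are computed from the ports of the whole remaining
  -- join. These must be known to be the ports of its blocks, whence the mutual recursion.
  ⊗R-port : ∀ {k n} (R : Rel₂ k) (H : Fin n → PGraph k) l u →
            port (⊗R-all R (tabulate H)) (from (⊗R-blocks R H) l u) ≡ port (H l) u
  ⊗R-port R H zero u
    rewrite splitAt-↑ˡ (size (pg (H zero))) u (size (pg (⊗R-all R (tabulate (H ∘ suc))))) = refl
  ⊗R-port R H (suc l) u
    rewrite splitAt-↑ʳ (size (pg (H zero))) (size (pg (⊗R-all R (tabulate (H ∘ suc)))))
                       (from (⊗R-blocks R (H ∘ suc)) l u) = ⊗R-port R (H ∘ suc) l u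

-- Block index and position within the block are common coordinates for the vertices of both graphs,
-- and in these coordinates `H` and `R` determine every edge.
Blocks⇒≅ : ∀ {G G′ k n} {R : Rel₂ k} {H : Fin n → PGraph k} → Blocks G R H → Blocks G′ R H → G ≅ G′
Blocks⇒≅ {G} {G′} {H = H} B B′ =
  mk↔ₛ′ (transfer B B′) (transfer B′ B) (transfer-inverse B′ B) (transfer-inverse B B′) , preserves
  where
  transfer : ∀ {G G′} → Blocks G _ H → Blocks G′ _ H → Fin (size G) → Fin (size G′)
  transfer B B′ x = let l , u , _ = cover B x in from B′ l u
  transfer-from : ∀ {G G′} (B : Blocks G _ H) (B′ : Blocks G′ _ H) l u →
                  transfer B B′ (from B l u) ≡ from B′ l u
  transfer-from B B′ l u with cover B (from B l u)
  ... | _ , _ , e with injective B e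
  ...   | refl = refl
  transfer-inverse : ∀ {G G′} (B : Blocks G _ H) (B′ : Blocks G′ _ H) x →
                     transfer B′ B (transfer B B′ x) ≡ x
  transfer-inverse B B′ x with cover B x
  ... | l , u , refl = transfer-from B′ B l u
  preserves-from : ∀ l u m v → adj G (from B l u) (from B m v) ≡ adj G′ (from B′ l u) (from B′ m v)
  preserves-from l u m v with l ≟ m
  ... | yes refl = trans (within B l u v) (sym (within B′ l u v))
  ... | no l≢m   = trans (across B u v l≢m) (sym (across B′ u v l≢m))
  preserves : ∀ x y → adj G x y ≡ adj G′ (transfer B B′ x) (transfer B B′ y)
  preserves x y with cover B x | cover B y
  ... | l , u , refl | m , v , refl = preserves-from l u m v

size-positive : ∀ {n} → Fin n → 1 ≤ n
size-positive {suc n} _ = s≤s z≤n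

first-vertex : ∀ {n} → 1 ≤ n → Fin n
first-vertex (s≤s _) = zero

orderable⇒CUT : ∀ 𝒞 → MSO₁-orderable 𝒞 → HasCUT 𝒞
orderable⇒CUT 𝒞 (m , φ , order) = (λ k → #types k φ * #types k φ) , bound
  where
  bound : HasCUT-f (λ k → #types k φ * #types k φ) 𝒞
  -- Orderability is only available for nonempty graphs. Without blocks the bound is trivial;
  -- otherwise the first block provides a vertex.
  bound G G∈𝒞 k zero    _ = z≤n
  bound G G∈𝒞 k (suc n) (R , Hs , nonempty , iso) =
    ordered⇒few-blocks B φ (proj₁ ordered) p (proj₂ ordered)
    where
    B : Blocks (raw G) R (Vec.lookup Hs)
    B = Blocks-iso (subst (λ Hs′ → raw G ≅ pg (⊗R-all R Hs′)) (sym (tabulate∘lookup Hs)) iso)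
                   (⊗R-blocks R (Vec.lookup Hs))
    p : ∀ l → Fin (size (pg (Vec.lookup Hs l)))
    p l = first-vertex (lookup⁺ nonempty l)
    ordered = order G G∈𝒞 (size-positive (from B zero (p zero)))

-- Leaves and least common ancestors

lookup-injective : ∀ {A : Set} {xs : List A} → Unique xs → ∀ i j → lookup xs i ≡ lookup xs j → i ≡ j
lookup-injective (_  ∷ _)      zero    zero    _ = refl
lookup-injective (x∉ ∷ _)      zero    (suc j) e = contradiction e (All.lookup x∉ (∈-lookup j))
lookup-injective (x∉ ∷ _)      (suc i) zero    e = contradiction (sym e) (All.lookup x∉ (∈-lookup i))
lookup-injective (_  ∷ unique) (suc i) (suc j) e = cong suc (lookup-injective unique i j e)

module _ (G : RawGraph) {k n} (R : Rel₂ k) (blk : Fin (size G) → Fin n) (prt : Fin (size G) → Fin k)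
         (nonempty : ∀ l → ∃[ x ] blk x ≡ l)
         (crossing : ∀ x y → blk x ≢ blk y → adj G x y ≡ R (prt x) (prt y) ∨ R (prt y) (prt x)) where

  fiber : Fin n → List (Fin (size G))
  fiber l = filter (λ x → blk x ≟ l) (allFin (size G))

  in-fiber : ∀ l u → blk (lookup (fiber l) u) ≡ l
  in-fiber l u = proj₂ (∈-filter⁻ (λ x → blk x ≟ l) {xs = allFin _} (∈-lookup u))

  find : ∀ {x l} → blk x ≡ l → ∃[ u ] lookup (fiber l) u ≡ x
  find {x} {l} x∈l = index x∈fiber , sym (lookup-index x∈fiber)
    where x∈fiber = ∈-filter⁺ (λ x → blk x ≟ l) (∈-allFin x) x∈l

  fiberGraph : Fin n → PGraph k
  fiberGraph l = record
    { pg   = record { size = length (fiber l)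
                    ; adj  = λ u v → adj G (lookup (fiber l) u) (lookup (fiber l) v) }
    ; port = λ u → prt (lookup (fiber l) u)
    }

  fiber-blocks : Blocks G R fiberGraph
  fiber-blocks = record
    { from      = λ l → lookup (fiber l)
    ; cover     = λ x → blk x , find refl
    ; injective = λ {l} {m} {u} {v} → injective′ l m u v
    ; within    = λ _ _ _ → refl
    ; across    = λ {l} {m} u v l≢m → crossing _ _ λ e →
        l≢m (trans (sym (in-fiber l u)) (trans e (in-fiber m v)))
    }
    where
    injective′ : ∀ l m u v → lookup (fiber l) u ≡ lookup (fiber m) v → (l , u) ≡ (m , v)
    injective′ l m u v e with trans (sym (in-fiber l u)) (trans (cong blk e) (in-fiber m v))
    ... | refl = cong (l ,_) (lookup-injective
                   (Unique.filter⁺ (λ x → blk x ≟ l) (Unique.allFin⁺ _)) u v e)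

  fibers-nonempty : ∀ l → 1 ≤ length (fiber l)
  fibers-nonempty l with find (proj₂ (nonempty l))
  ... | u , _ = size-positive u

-- A cut amounts to a partition with port labels that determine the edges between its parts: the
-- induced subgraphs on the parts are blocks both of `G` and of their join, so `Blocks⇒≅` applies.
partition⇒cut : ∀ (G : Graph) {k n} (R : Rel₂ k) blk prt → (∀ l → ∃[ x ] blk x ≡ l) →
  (∀ x y → blk x ≢ blk y → adj (raw G) x y ≡ R (prt x) (prt y) ∨ R (prt y) (prt x)) →
  CutDecomp G k n
partition⇒cut G R blk prt nonempty crossing =
  R , tabulate H , tabulate⁺ (fibers-nonempty (raw G) R blk prt nonempty crossing) ,
  Blocks⇒≅ (fiber-blocks (raw G) R blk prt nonempty crossing) (⊗R-blocks R H)
  where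
  H = fiberGraph (raw G) R blk prt nonempty crossing

dual : Op → Op
dual ⊕op = ⊗op
dual ⊗op = ⊕op

isTensor : Op → Bool
isTensor ⊕op = false
isTensor ⊗op = true

data Pos : Cotree → Set where
  root  : Pos leaf
  child : ∀ {o ts} (i : Fin (length ts)) → Pos (lookup ts i) → Pos (node o ts)

module _ {ℓ} (P : Cotree → Set ℓ) (P-leaf : P leaf)
         (P-node : ∀ o ts → (∀ i → P (lookup ts i)) → P (node o ts)) where

  mutual
    -- Recursion on `lookup ts i` is not structural, so the induction hypotheses for the children
    -- come from a separate traversal of the list.
    Cotree-ind : ∀ T → P T
    Cotree-ind leaf        = P-leaf
    Cotree-ind (node o ts) = P-node o ts (Cotrees-ind ts)

    Cotrees-ind : ∀ ts i → P (lookup ts i)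
    Cotrees-ind (T ∷ _)  zero    = Cotree-ind T
    Cotrees-ind (_ ∷ ts) (suc i) = Cotrees-ind ts i

-- Meet o p q: the least common ancestor of p ≢ q is labelled o.
data Meet : ∀ {T} → Op → Pos T → Pos T → Set where
  split : ∀ {o ts i j} {p : Pos (lookup ts i)} {q : Pos (lookup ts j)} → i ≢ j →
          Meet o (child {o} {ts} i p) (child j q)
  under : ∀ {o o′ ts i} {p q : Pos (lookup ts i)} → Meet o p q →
          Meet o (child {o′} {ts} i p) (child i q)

data Compare {T} (p q : Pos T) : Set where
  equal : p ≡ q → Compare p q
  meets : ∀ o → Meet o p q → Compare p q

compare : ∀ {T} (p q : Pos T) → Compare p q
compare root root = equal refl
compare (child {o} i p) (child j q) with i ≟ j
... | no i≢j = meets o (split i≢j)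
... | yes refl with compare p q
...   | equal e   = equal (cong (child i) e)
...   | meets o m = meets o (under m)

Meet-irrefl : ∀ {T o} {p : Pos T} → ¬ Meet o p p
Meet-irrefl (split i≢i) = i≢i refl
Meet-irrefl (under m)   = Meet-irrefl m

Meet-unique : ∀ {T o o′} {p q : Pos T} → Meet o p q → Meet o′ p q → o ≡ o′
Meet-unique (split _)   (split _)   = refl
Meet-unique (split i≢i) (under _)   = contradiction refl i≢i
Meet-unique (under _)   (split i≢i) = contradiction refl i≢i
Meet-unique (under m)   (under m′)  = Meet-unique m m′

dual≢ : ∀ {o} → o ≢ dual o
dual≢ {⊕op} ()
dual≢ {⊗op} ()

Meet-exclusive : ∀ {T o} {p q : Pos T} → Meet o p q → ¬ Meet (dual o) p q
Meet-exclusive m m′ = dual≢ (Meet-unique m m′)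

-- One port suffices, because whether leaves below different children of a node are adjacent depends
-- on its label alone.
children : (ts : List Cotree) → Fin (length ts) → PGraph 1
children ts i = record { pg = ⟦ lookup ts i ⟧ ; port = λ _ → zero }

cotree-blocks : ∀ o ts → Blocks ⟦ o ∣ ts ⟧s (λ _ _ → isTensor o) (children ts)
cotree-blocks o   []       = record
  { from = λ () ; cover = λ () ; injective = λ { {()} } ; within = λ () ; across = λ { {()} } }
cotree-blocks ⊕op (T ∷ ts) = Blocks-∷ (children (T ∷ ts)) (cotree-blocks ⊕op ts) _ λ _ _ _ → refl
cotree-blocks ⊗op (T ∷ ts) = Blocks-∷ (children (T ∷ ts)) (cotree-blocks ⊗op ts) _ λ _ _ _ → refl

vertex : ∀ {T} → Pos T → Fin (size ⟦ T ⟧)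
vertex root                     = zero
vertex (child {o} {ts} i p) = from (cotree-blocks o ts) i (vertex p)

vertex-injective : ∀ {T} {p q : Pos T} → vertex p ≡ vertex q → p ≡ q
vertex-injective {p = root} {root} _ = refl
vertex-injective {p = child {o} {ts} i p} {child j q} e with i ≟ j
... | no i≢j   = contradiction (cong proj₁ (injective (cotree-blocks o ts) e)) i≢j
... | yes refl = cong (child i) (vertex-injective (from-injective (cotree-blocks o ts) e))

vertex-surjective : ∀ T (x : Fin (size ⟦ T ⟧)) → ∃[ p ] vertex {T} p ≡ x
vertex-surjective = Cotree-ind _ (λ { zero → root , refl }) surjective
  where
  surjective : ∀ o ts → (∀ i (x : Fin (size ⟦ lookup ts i ⟧)) → ∃[ p ] vertex {lookup ts i} p ≡ x) →
               ∀ x → ∃[ p ] vertex {node o ts} p ≡ x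
  surjective o ts rec x with cover (cotree-blocks o ts) x
  ... | i , u , refl with rec i u
  ...   | p , refl = child i p , refl

vertex-adj : ∀ {T o} {p q : Pos T} → Meet o p q → adj ⟦ T ⟧ (vertex p) (vertex q) ≡ isTensor o
vertex-adj (split {o} {ts} i≢j) =
  trans (across (cotree-blocks o ts) _ _ i≢j) (∨-idem (isTensor o))
vertex-adj (under {o′ = o} {ts} m) = trans (within (cotree-blocks o ts) _ _ _) (vertex-adj m)

record Leaves (G : RawGraph) (T : Cotree) : Set where
  field
    bij      : Fin (size G) ↔ Pos T
    adj-meet : ∀ {o x y} → Meet o (Inverse.to bij x) (Inverse.to bij y) → adj G x y ≡ isTensor o
  open Inverse bij public

≅⇒Leaves : ∀ {G T} → G ≅ ⟦ T ⟧ → Leaves G T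
≅⇒Leaves {G} {T} (f , f-adj) = record
  { bij      = mk↔ₛ′ pos (g ∘ vertex)
                     (λ p → vertex-injective (trans (vertex-pos (g (vertex p)))
                                                    (strictlyInverseˡ f (vertex p))))
                     (λ x → trans (cong g (vertex-pos x)) (strictlyInverseʳ f x))
  ; adj-meet = λ {o} {x} {y} m → trans (f-adj x y)
      (trans (sym (cong₂ (adj ⟦ T ⟧) (vertex-pos x) (vertex-pos y))) (vertex-adj m))
  }
  where
  open Inverse using (strictlyInverseˡ; strictlyInverseʳ)
  g = Inverse.from f
  pos : Fin (size G) → Pos T
  pos x = proj₁ (vertex-surjective T (Inverse.to f x))
  vertex-pos : ∀ x → vertex (pos x) ≡ Inverse.to f x
  vertex-pos x = proj₂ (vertex-surjective T (Inverse.to f x))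

valid-child : ∀ {o ts} → ValidCotree (node o ts) → ∀ i → ValidCotree (lookup ts i)
valid-child (node-valid _ _ _ valid _) i = All.lookup valid (∈-lookup i)

child-label : ∀ {o ts} → ValidCotree (node o ts) → ∀ i → label (lookup ts i) ≢ just o
child-label (node-valid _ _ _ _ labels) i = All.lookup labels (∈-lookup i)

some-leaf : ∀ {T} → ValidCotree T → Pos T
some-leaf leaf-valid = root
some-leaf (node-valid _ (_ ∷ _) _ (valid ∷ _) _) = child zero (some-leaf valid)

data _⊑_ (S : Cotree) : Cotree → Set where
  here : S ⊑ S
  down : ∀ {o ts} i → S ⊑ lookup ts i → S ⊑ node o ts

⊑-valid : ∀ {S T} → S ⊑ T → ValidCotree T → ValidCotree S
⊑-valid here       v = v
⊑-valid (down i s) v = ⊑-valid s (valid-child v i)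

module _ {d : ℕ} where
  mutual
    outdeg-bound : ∀ T → (∀ {o ts} → node o ts ⊑ T → length ts ≤ d) → outdeg T ≤ d
    outdeg-bound leaf        _     = z≤n
    outdeg-bound (node o ts) bound = ⊔-lub (bound here) (outdegs-bound ts λ i s → bound (down i s))

    outdegs-bound : ∀ ts → (∀ {o us} i → node o us ⊑ lookup ts i → length us ≤ d) → outdegs ts ≤ d
    outdegs-bound []       _     = z≤n
    outdegs-bound (T ∷ ts) bound =
      ⊔-lub (outdeg-bound T (bound zero)) (outdegs-bound ts (λ i → bound (suc i)))

embed : ∀ {S T} → S ⊑ T → Pos S → Pos T
embed here       p = p
embed (down i s) p = child i (embed s p)

-- All leaves below `S` meet an outside leaf in the same node, where its path leaves the path to
-- `S`. Adjacency depends only on the label of this node, which is returned.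
locate : ∀ {S T} → S ⊑ T → Pos T → Pos S ⊎ Op
locate here p = inj₁ p
locate (down {o} i s) (child j p) with i ≟ j
... | yes refl = locate s p
... | no _     = inj₂ o

locate-embed : ∀ {S T} (s : S ⊑ T) p → locate s (embed s p) ≡ inj₁ p
locate-embed here p = refl
locate-embed (down i s) p with i ≟ i
... | yes refl = locate-embed s p
... | no i≢i   = contradiction refl i≢i

locate-meet : ∀ {S T o} (s : S ⊑ T) {p q : Pos T} {p′ q′} → locate s p ≡ inj₁ p′ → locate s q ≡ inj₁ q′ →
              Meet o p′ q′ → Meet o p q
locate-meet here refl refl m = m
locate-meet (down i s) {child j p} {child k q} e f m with i ≟ j | i ≟ k
... | yes refl | yes refl = under (locate-meet s e f m)
locate-meet (down i s) {child j p} {child k q} e () m | yes refl | no _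
locate-meet (down i s) {child j p} {child k q} () f m | no _ | _

locate-meet-outside : ∀ {S T o} (s : S ⊑ T) {p q : Pos T} {p′} →
                      locate s p ≡ inj₁ p′ → locate s q ≡ inj₂ o → Meet o p q × Meet o q p
locate-meet-outside here {p} {q} e ()
locate-meet-outside (down i s) {child j p} {child k q} e f with i ≟ j | i ≟ k
... | yes refl | yes refl = let m , m′ = locate-meet-outside s e f in under m , under m′
locate-meet-outside (down i s) {child j p} {child k q} e refl | yes refl | no i≢k =
  split i≢k , split (i≢k ∘ sym)
locate-meet-outside (down i s) {child j p} {child k q} () f | no _ | _

-- Port 0 marks the leaves below the chosen node, ports 1 and 2 the outside leaves that are
-- adjacent, respectively not adjacent, to all of these.
nodePort : ∀ {S} → Pos S ⊎ Op → Fin 3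
nodePort (inj₁ _)   = zero
nodePort (inj₂ ⊗op) = suc zero
nodePort (inj₂ ⊕op) = suc (suc zero)

nodeRel : Op → Rel₂ 3
nodeRel o zero zero       = isTensor o
nodeRel o zero (suc zero) = true
nodeRel o _    _          = false

-- With all outside leaves in one block, ports only have to describe edges that touch a leaf below
-- the node, and an outside leaf is adjacent to all of those or to none.
nodeBlock : ∀ {o T ts} → Pos (node o (T ∷ ts)) ⊎ Op → Fin (suc (length ts))
nodeBlock (inj₁ (child i _)) = i
nodeBlock (inj₂ _)           = zero

node-cut : ∀ (G : Graph) {T o ts} → ValidCotree T → raw G ≅ ⟦ T ⟧ → node o ts ⊑ T →
           CutDecomp G 3 (length ts)
node-cut G {T} {o} {ts} valid iso s with ⊑-valid s valid
... | node-valid .o (U ∷ us) _ children-valid _ =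
  partition⇒cut G (nodeRel o) (nodeBlock ∘ where-is) (nodePort ∘ where-is) nonempty crossing
  where
  L = ≅⇒Leaves iso
  open Leaves L using (to; adj-meet; strictlyInverseˡ)
  where-is : Fin (size (raw G)) → Pos (node o (U ∷ us)) ⊎ Op
  where-is x = locate s (to x)
  nonempty : ∀ l → ∃[ x ] nodeBlock (where-is x) ≡ l
  nonempty l = Leaves.from L (embed s p) ,
    trans (cong (nodeBlock ∘ locate s) (strictlyInverseˡ (embed s p)))
          (cong nodeBlock (locate-embed s p))
    where p = child l (some-leaf (All.lookup children-valid (∈-lookup l)))
  crossing : ∀ x y → nodeBlock (where-is x) ≢ nodeBlock (where-is y) →
             adj (raw G) x y ≡ nodeRel o (nodePort (where-is x)) (nodePort (where-is y)) ∨
                               nodeRel o (nodePort (where-is y)) (nodePort (where-is x))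
  crossing x y apart with locate s (to x) in ex | locate s (to y) in ey
  ... | inj₁ (child i p) | inj₁ (child j q) =
    trans (adj-meet (locate-meet s ex ey (split apart))) (sym (∨-idem (isTensor o)))
  ... | inj₁ p   | inj₂ ⊕op = adj-meet (proj₁ (locate-meet-outside s ex ey))
  ... | inj₁ p   | inj₂ ⊗op = adj-meet (proj₁ (locate-meet-outside s ex ey))
  ... | inj₂ ⊕op | inj₁ q   = adj-meet (proj₂ (locate-meet-outside s ey ex))
  ... | inj₂ ⊗op | inj₁ q   = adj-meet (proj₂ (locate-meet-outside s ey ex))
  ... | inj₂ _   | inj₂ _   = contradiction refl apart

CUT⇒bounded : ∀ 𝒞 → HasCUT 𝒞 → BoundedCotreeOutdeg 𝒞
CUT⇒bounded 𝒞 (f , cut) = f 3 , λ G G∈𝒞 T valid iso →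
  outdeg-bound T λ s → cut G G∈𝒞 3 _ (node-cut G valid iso s)

-- Definability of the children of a least common ancestor

SatT : ∀ {T i j} → (Fin i → Pos T) → (Fin j → Pos T → Bool) → Formula i j → Set
SatT ρ σ (eq x y)   = ρ x ≡ ρ y
SatT ρ σ (edg x y)  = Meet ⊗op (ρ x) (ρ y)
SatT ρ σ (mem x X)  = σ X (ρ x) ≡ true
SatT ρ σ (neg φ)    = ¬ SatT ρ σ φ
SatT ρ σ (conj φ ψ) = SatT ρ σ φ × SatT ρ σ ψ
SatT ρ σ (ex₁ φ)    = ∃[ p ] SatT (extend p ρ) σ φ
SatT ρ σ (ex₂ φ)    = ∃[ P ] SatT ρ (extend P σ) φ

module _ (G : Graph) {T} (L : Leaves (raw G) T) where

  private module L = Leaves L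

  to-injective : ∀ {x y} → L.to x ≡ L.to y → x ≡ y
  to-injective {x} {y} e = begin
    x                ≡⟨ L.strictlyInverseʳ x ⟨
    L.from (L.to x)  ≡⟨ cong L.from e ⟩
    L.from (L.to y)  ≡⟨ L.strictlyInverseʳ y ⟩
    y                ∎
    where open ≡-Reasoning

  adj⇔Meet : ∀ x y → adj (raw G) x y ≡ true ⇔ Meet ⊗op (L.to x) (L.to y)
  adj⇔Meet x y = mk⇔ adj⇒Meet L.adj-meet
    where
    adj⇒Meet : adj (raw G) x y ≡ true → Meet ⊗op (L.to x) (L.to y)
    adj⇒Meet xy with compare (L.to x) (L.to y)
    adj⇒Meet xy | equal e with to-injective e
    ... | refl = contradiction (trans (sym xy) (IsSimple.irreflexive (simple G) x)) λ ()
    adj⇒Meet xy | meets ⊗op m = m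
    adj⇒Meet xy | meets ⊕op m = contradiction (trans (sym xy) (L.adj-meet m)) λ ()

  -- Sets are compared pointwise, because a witness `P` of `ex₂` is carried over as `P ∘ L.from`,
  -- and composing this with `L.to` gives `P` back only pointwise.
  Sat⇔SatT : ∀ {i j} (φ : Formula i j) {ρ σ ρ′ σ′} →
             (∀ x → L.to (ρ x) ≡ ρ′ x) → (∀ X v → σ X v ≡ σ′ X (L.to v)) →
             Sat (raw G) ρ σ φ ⇔ SatT ρ′ σ′ φ
  Sat⇔SatT (eq x y) {ρ} ρ≡ σ≡ = mk⇔
    (λ e → trans (sym (ρ≡ x)) (trans (cong L.to e) (ρ≡ y)))
    (λ e → to-injective (trans (ρ≡ x) (trans e (sym (ρ≡ y)))))
  Sat⇔SatT (edg x y) {ρ} ρ≡ σ≡ = subst₂ (λ p q → adj (raw G) (ρ x) (ρ y) ≡ true ⇔ Meet ⊗op p q)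
    (ρ≡ x) (ρ≡ y) (adj⇔Meet (ρ x) (ρ y))
  Sat⇔SatT (mem x X) {ρ} {σ} {ρ′} {σ′} ρ≡ σ≡ = mk⇔ (trans (sym e)) (trans e)
    where
    e : σ X (ρ x) ≡ σ′ X (ρ′ x)
    e = trans (σ≡ X (ρ x)) (cong (σ′ X) (ρ≡ x))
  Sat⇔SatT (neg φ) ρ≡ σ≡ =
    let φ⇔ = Sat⇔SatT φ ρ≡ σ≡ in mk⇔ (_∘ back φ⇔) (_∘ forth φ⇔)
  Sat⇔SatT (conj φ ψ) ρ≡ σ≡ =
    let φ⇔ = Sat⇔SatT φ ρ≡ σ≡ ; ψ⇔ = Sat⇔SatT ψ ρ≡ σ≡ in
    mk⇔ (λ (p , q) → forth φ⇔ p , forth ψ⇔ q) (λ (p , q) → back φ⇔ p , back ψ⇔ q)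
  Sat⇔SatT (ex₁ φ) ρ≡ σ≡ = mk⇔
    (λ (v , p) → L.to v , forth (Sat⇔SatT φ (λ { zero → refl ; (suc x) → ρ≡ x }) σ≡) p)
    (λ (v , p) → L.from v ,
      back (Sat⇔SatT φ (λ { zero → L.strictlyInverseˡ v ; (suc x) → ρ≡ x }) σ≡) p)
  Sat⇔SatT (ex₂ φ) ρ≡ σ≡ = mk⇔
    (λ (P , p) → P ∘ L.from ,
      forth (Sat⇔SatT φ ρ≡ λ { zero v → cong P (sym (L.strictlyInverseʳ v)) ; (suc X) v → σ≡ X v }) p)
    (λ (P , p) → P ∘ L.to ,
      back (Sat⇔SatT φ ρ≡ λ { zero v → refl ; (suc X) v → σ≡ X v }) p)

_≟ᵒ_ : (o o′ : Op) → Dec (o ≡ o′)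
⊕op ≟ᵒ ⊕op = yes refl
⊕op ≟ᵒ ⊗op = no λ ()
⊗op ≟ᵒ ⊕op = no λ ()
⊗op ≟ᵒ ⊗op = yes refl

dual-of-≢ : ∀ {o o′} → o′ ≢ o → o′ ≡ dual o
dual-of-≢ {⊕op} {⊕op} ne = contradiction refl ne
dual-of-≢ {⊕op} {⊗op} ne = refl
dual-of-≢ {⊗op} {⊕op} ne = refl
dual-of-≢ {⊗op} {⊗op} ne = contradiction refl ne

Meet-sym : ∀ {T o} {p q : Pos T} → Meet o p q → Meet o q p
Meet-sym (split i≢j) = split (i≢j ∘ sym)
Meet-sym (under m)   = under (Meet-sym m)

Meet? : ∀ {T} o (p q : Pos T) → Dec (Meet o p q)
Meet? o p q with compare p q
... | equal refl = no Meet-irrefl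
... | meets o′ m with o′ ≟ᵒ o
...   | yes refl = yes m
...   | no o′≢o  = no λ m′ → o′≢o (Meet-unique m m′)

any-Pos? : ∀ T {P : Pos T → Set} → (∀ p → Dec (P p)) → Dec (∃ P)
any-Pos? T = Cotree-ind (λ T → {P : Pos T → Set} → (∀ p → Dec (P p)) → Dec (∃ P))
  (λ P? → map′ (root ,_) (λ { (root , p) → p }) (P? root))
  (λ o ts rec P? → map′ (λ (i , p , q) → child i p , q) (λ { (child i p , q) → i , p , q })
                        (any? λ i → rec i λ p → P? (child i p)))
  T

-- Comp p q r: r lies below the child of lca(p , q) that contains p.
data Comp : ∀ {T} → Pos T → Pos T → Pos T → Set where
  split : ∀ {o ts i j p q r} → i ≢ j → Comp (child {o} {ts} i p) (child j q) (child i r)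
  under : ∀ {o ts i p q r} → Comp p q r → Comp (child {o} {ts} i p) (child i q) (child i r)

Comp? : ∀ {T} (p q r : Pos T) → Dec (Comp p q r)
Comp? root root root = no λ ()
Comp? (child i p) (child j q) (child k r) with k ≟ i
... | no k≢i = no λ { (split _) → k≢i refl ; (under _) → k≢i refl }
... | yes refl with i ≟ j
...   | no i≢j = yes (split i≢j)
...   | yes refl = map′ under (λ { (split i≢i) → contradiction refl i≢i ; (under c) → c }) (Comp? p q r)

Meet-under⁻ : ∀ {o o′ ts i} {p q : Pos (lookup ts i)} →
              Meet o (child {o′} {ts} i p) (child i q) → Meet o p q
Meet-under⁻ (split i≢i) = contradiction refl i≢i
Meet-under⁻ (under m)   = m

Meet-split⁻ : ∀ {o o′ ts i j} {p : Pos (lookup ts i)} {q : Pos (lookup ts j)} → i ≢ j →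
              Meet o (child {o′} {ts} i p) (child j q) → o ≡ o′
Meet-split⁻ i≢j (split _) = refl
Meet-split⁻ i≢i (under _) = contradiction refl i≢i

-- Since ¬ Meet o means equal or Meet (dual o), this says that r is at distance at most two from p in
-- the graph of Meet (dual o), by a path that avoids q and its neighbours.  Below the child of lca(p , q)
-- any two leaves have distance at most two, and a neighbour of p outside is also a neighbour of q.
Linked : ∀ {T} → Op → Pos T → Pos T → Pos T → Set
Linked o p q r = ∃[ e ] (¬ Meet o r e × ¬ Meet o e p) × (¬ Meet (dual o) r q × ¬ Meet (dual o) e q)

another-child : ∀ {o ts} → ValidCotree (node o ts) → (i : Fin (length ts)) → ∃[ j ] j ≢ i
another-child {ts = _ ∷ _ ∷ _} _ zero    = suc zero , λ ()
another-child {ts = _ ∷ _ ∷ _} _ (suc i) = zero , λ ()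
another-child {ts = _ ∷ []} (node-valid _ _ (s≤s ()) _ _)
another-child {ts = []}     (node-valid _ _ () _ _)

-- The root of `S` is not labelled `o`, so leaves below different children of it never meet in `o`.
-- If `p` and `r` meet in `o`, they lie below one child, and any leaf below another child links
-- them.
linked-in-child : ∀ {S o} → ValidCotree S → label S ≢ just o → (p r : Pos S) →
                  ∃[ e ] ¬ Meet o r e × ¬ Meet o e p
linked-in-child {o = o} valid ≢o p r with Meet? o r p
... | no ¬rp        = p , ¬rp , Meet-irrefl
... | yes (split _) = contradiction refl ≢o
linked-in-child {o = o} valid ≢o (child k p) (child .k r) | yes (under _) =
  let l , l≢k = another-child valid k in
  child l (some-leaf (valid-child valid l)) ,
  (λ m → ≢o (cong just (sym (Meet-split⁻ (l≢k ∘ sym) m)))) ,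
  (λ m → ≢o (cong just (sym (Meet-split⁻ l≢k m))))

Comp⇒Linked : ∀ {T o} {p q r : Pos T} → ValidCotree T → Meet o p q → Comp p q r → Linked o p q r
Comp⇒Linked valid (split {i = i} i≢j) (split {p = p} {r = r} _) =
  let e , ¬re , ¬ep = linked-in-child (valid-child valid i) (child-label valid i) p r in
  child i e , (¬re ∘ Meet-under⁻ , ¬ep ∘ Meet-under⁻) ,
  -- Both `r` and `e` lie below child `i`, so they meet `q` in this node, which is labelled `o`.
  (dual≢ ∘ sym ∘ Meet-split⁻ i≢j , dual≢ ∘ sym ∘ Meet-split⁻ i≢j)
Comp⇒Linked valid (split i≢i) (under _) = contradiction refl i≢i
Comp⇒Linked valid (under m) (split i≢i) = contradiction refl i≢i
Comp⇒Linked valid (under {i = i} m) (under c) =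
  let e , (¬re , ¬ep) , (¬rq , ¬eq) = Comp⇒Linked (valid-child valid i) m c in
  child i e , (¬re ∘ Meet-under⁻ , ¬ep ∘ Meet-under⁻) , (¬rq ∘ Meet-under⁻ , ¬eq ∘ Meet-under⁻)

-- A leaf branching off at a node common to the paths of `p` and `q` meets both there. It is caught
-- by the condition on `p` if that node is labelled `o`, and by the condition on `q` otherwise.
Meet-outside : ∀ {o o′ ts i j} {p q : Pos (lookup ts i)} {r : Pos (lookup ts j)} → j ≢ i →
  Meet o (child {o′} {ts} j r) (child i p) ⊎ Meet (dual o) (child {o′} {ts} j r) (child i q)
Meet-outside {o} {o′} j≢i with o′ ≟ᵒ o
... | yes refl = inj₁ (split j≢i)
... | no o′≢o with dual-of-≢ o′≢o
...   | refl = inj₂ (split j≢i)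

-- A linking path cannot leave the child: first `e` is kept in it by `p`, then `r` by `e`. Leaving
-- at the least common ancestor creates a meet labelled `o`; leaving above it is excluded by
-- `Meet-outside`.
Linked⇒Comp : ∀ {T o} {p q r : Pos T} → Meet o p q → Linked o p q r → Comp p q r
Linked⇒Comp {p = child i p} {child j q} {child k r} (split i≢j) (child l e , (¬re , ¬ep) , _) with l ≟ i
... | no l≢i   = contradiction (split l≢i) ¬ep
... | yes refl with k ≟ i
...   | no k≢i   = contradiction (split k≢i) ¬re
...   | yes refl = split i≢j
Linked⇒Comp {o = o} {p = child {o′} i p} {child .i q} {child k r} (under m)
            (child l e , (¬re , ¬ep) , (¬rq , ¬eq)) with l ≟ i
... | no l≢i = contradiction (Meet-outside l≢i) [ ¬ep , ¬eq ]
... | yes refl with k ≟ i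
...   | no k≢i = contradiction (Meet-outside k≢i) [ ¬re , ¬rq ]
...   | yes refl = under (Linked⇒Comp m (e , (¬re ∘ under , ¬ep ∘ under) , (¬rq ∘ under , ¬eq ∘ under)))

-- Kernel C Q: some subset of Q is a maximal clique of the subgraph induced by C.
Kernel : ∀ {T} → (Pos T → Set) → (Pos T → Bool) → Set
Kernel {T} C Q = Σ (Pos T → Bool) λ Y →
  (∀ c → Y c ≡ true → C c × Q c ≡ true) ×
  (∀ c d → Y c ≡ true → Y d ≡ true → ¬ Meet ⊕op c d) ×
  (∀ c → C c → Y c ≢ true → ∃[ d ] Y d ≡ true × Meet ⊕op c d)

-- Maximal cliques and the children of a node

Everywhere : ∀ {T} → Pos T → Set
Everywhere _ = ⊤

MaxClique : ∀ T → (Pos T → Bool) → Set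
MaxClique T = Kernel {T} Everywhere

under-child : ∀ {o ts} i → (Pos (lookup ts i) → Bool) → Pos (node o ts) → Bool
under-child i Y (child j p) with j ≟ i
... | yes refl = Y p
... | no _     = false

under-child-≡ : ∀ {o ts} i Y p → under-child {o} {ts} i Y (child i p) ≡ Y p
under-child-≡ i Y p with i ≟ i
... | yes refl = refl
... | no i≢i   = contradiction refl i≢i

under-child-true : ∀ {o ts} i Y c → under-child {o} {ts} i Y c ≡ true →
                   ∃[ p ] c ≡ child i p × Y p ≡ true
under-child-true i Y (child j p) e with j ≟ i
under-child-true i Y (child j p) e  | yes refl = p , refl , e
under-child-true i Y (child j p) () | no _

-- Maximality tests positions of the range against members of `Y`. If the range is confined to one
-- child, then so is `Y`, and the surrounding tree has no influence.
Kernel-child : ∀ {o ts} i {C : Pos (lookup ts i) → Set} {C′ : Pos (node o ts) → Set} {Q} →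
  (∀ p → C p ⇔ C′ (child i p)) → (∀ c → C′ c → ∃[ p ] c ≡ child i p) →
  Kernel C (Q ∘ child i) ⇔ Kernel C′ Q
Kernel-child {o} {ts} i {C} {C′} {Q} C⇔ inside = mk⇔ extend-kernel restrict-kernel
  where
  extend-kernel : Kernel C (Q ∘ child i) → Kernel C′ Q
  extend-kernel (Y , Y⊆ , clique , maximal) = under-child i Y , Y⊆′ , clique′ , maximal′
    where
    Y⊆′ : ∀ (c : Pos (node _ ts)) → under-child i Y c ≡ true → C′ c × Q c ≡ true
    Y⊆′ c e with under-child-true i Y c e
    ... | p , refl , Yp = let Cp , Qp = Y⊆ p Yp in forth (C⇔ p) Cp , Qp
    clique′ : ∀ (c d : Pos (node _ ts)) →
              under-child i Y c ≡ true → under-child i Y d ≡ true → ¬ Meet ⊕op c d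
    clique′ c d e f m with under-child-true i Y c e | under-child-true i Y d f
    ... | p , refl , Yp | q , refl , Yq = clique p q Yp Yq (Meet-under⁻ m)
    maximal′ : ∀ (c : Pos (node _ ts)) → C′ c →
               under-child i Y c ≢ true → ∃[ d ] under-child i Y d ≡ true × Meet ⊕op c d
    maximal′ c C′c ¬Yc with inside c C′c
    ... | p , refl with maximal p (back (C⇔ p) C′c) (¬Yc ∘ trans (under-child-≡ {o} {ts} i Y p))
    ...   | d , Yd , m = child i d , trans (under-child-≡ {o} {ts} i Y d) Yd , under m
  restrict-kernel : Kernel C′ Q → Kernel C (Q ∘ child i)
  restrict-kernel (Y , Y⊆ , clique , maximal) = Y ∘ child i
    , (λ p Yp → let C′p , Qp = Y⊆ _ Yp in back (C⇔ p) C′p , Qp)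
    , (λ p q Yp Yq m → clique _ _ Yp Yq (under m))
    , maximal′
    where
    maximal′ : ∀ p → C p → Y (child i p) ≢ true → ∃[ d ] Y (child i d) ≡ true × Meet ⊕op p d
    maximal′ p Cp ¬Yp with maximal (child i p) (forth (C⇔ p) Cp) ¬Yp
    ... | d , Yd , m with inside d (proj₁ (Y⊆ d Yd))
    ...   | q , refl = q , Yd , Meet-under⁻ m

MaxClique-leaf : ∀ {Q} → MaxClique leaf Q ⇔ Q root ≡ true
MaxClique-leaf {Q} = mk⇔ member λ Qr → (λ _ → true) , (λ { root _ → tt , Qr }) ,
                                       (λ { root root _ _ () }) , (λ _ _ ¬t → contradiction refl ¬t)
  where
  member : MaxClique leaf Q → Q root ≡ true
  member (Y , Y⊆ , _ , maximal) with Y root in e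
  ... | true  = proj₂ (Y⊆ root e)
  ... | false with maximal root tt (λ t → contradiction (trans (sym e) t) λ ())
  ...   | root , _ , ()

-- The empty clique is not maximal, because a valid cotree has a leaf.
MaxClique-member : ∀ {T Q} → ValidCotree T → ((Y , _) : MaxClique T Q) → ∃[ d ] Y d ≡ true
MaxClique-member valid (Y , _ , _ , maximal) with Y (some-leaf valid) in e
... | true  = some-leaf valid , e
... | false with maximal (some-leaf valid) tt (λ t → contradiction (trans (sym e) t) λ ())
...   | d , Yd , _ = d , Yd

-- Nonadjacency never crosses between children of a tensor node, so the clique and maximality
-- conditions split into independent conditions on the children.
MaxClique-⊗ : ∀ {ts Q} → MaxClique (node ⊗op ts) Q ⇔ (∀ i → MaxClique (lookup ts i) (Q ∘ child i))
MaxClique-⊗ {ts} {Q} = mk⇔ restrict glue-all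
  where
  restrict : MaxClique (node ⊗op ts) Q → ∀ i → MaxClique (lookup ts i) (Q ∘ child i)
  restrict (Y , Y⊆ , clique , maximal) i = Y ∘ child i
    , (λ p Yp → tt , proj₂ (Y⊆ _ Yp))
    , (λ p q Yp Yq m → clique _ _ Yp Yq (under m))
    , maximal′
    where
    maximal′ : ∀ p → ⊤ → Y (child i p) ≢ true → ∃[ d ] Y (child i d) ≡ true × Meet ⊕op p d
    maximal′ p _ ¬Yp with maximal (child i p) tt ¬Yp
    ... | child .i d , Yd , under m = d , Yd , m
  glue-all : (∀ i → MaxClique (lookup ts i) (Q ∘ child i)) → MaxClique (node ⊗op ts) Q
  glue-all K = Y
    , (λ { (child i p) Yp → tt , proj₂ (proj₁ (proj₂ (K i)) p Yp) })
    , (λ { (child i p) (child .i q) Yp Yq (under m) → proj₁ (proj₂ (proj₂ (K i))) p q Yp Yq m })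
    , λ { (child i p) _ ¬Yp → let d , Yd , m = proj₂ (proj₂ (proj₂ (K i))) p tt ¬Yp in
                              child i d , Yd , under m }
    where
    Y : Pos (node ⊗op ts) → Bool
    Y (child i p) = proj₁ (K i) p

-- A clique of a disjoint union stays within one child. Conversely, a maximal clique of one child is
-- nonempty, and its members are nonadjacent to every leaf of the other children.
MaxClique-⊕ : ∀ {ts Q} → ValidCotree (node ⊕op ts) →
              MaxClique (node ⊕op ts) Q ⇔ (∃[ i ] MaxClique (lookup ts i) (Q ∘ child i))
MaxClique-⊕ {ts} {Q} valid = mk⇔ restrict extend-one
  where
  restrict : MaxClique (node ⊕op ts) Q → ∃[ i ] MaxClique (lookup ts i) (Q ∘ child i)
  restrict K@(Y , Y⊆ , clique , maximal) with MaxClique-member valid K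
  ... | child i x , Yx = i , Y ∘ child i
    , (λ p Yp → tt , proj₂ (Y⊆ _ Yp))
    , (λ p q Yp Yq m → clique _ _ Yp Yq (under m))
    , maximal′
    where
    maximal′ : ∀ p → ⊤ → Y (child i p) ≢ true → ∃[ d ] Y (child i d) ≡ true × Meet ⊕op p d
    maximal′ p _ ¬Yp with maximal (child i p) tt ¬Yp
    ... | child .i d , Yd , under m   = d , Yd , m
    ... | child j d  , Yd , split i≢j = contradiction (split i≢j) (clique _ _ Yx Yd)
  extend-one : (∃[ i ] MaxClique (lookup ts i) (Q ∘ child i)) → MaxClique (node ⊕op ts) Q
  extend-one (i , K@(Y , Y⊆ , clique , maximal)) = under-child i Y , Y⊆′ , clique′ , maximal′
    where
    Y⊆′ : ∀ (c : Pos (node _ ts)) → under-child i Y c ≡ true → ⊤ × Q c ≡ true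
    Y⊆′ c e with under-child-true i Y c e
    ... | p , refl , Yp = Y⊆ p Yp
    clique′ : ∀ (c d : Pos (node _ ts)) →
              under-child i Y c ≡ true → under-child i Y d ≡ true → ¬ Meet ⊕op c d
    clique′ c d e f m with under-child-true i Y c e | under-child-true i Y d f
    ... | p , refl , Yp | q , refl , Yq = clique p q Yp Yq (Meet-under⁻ m)
    maximal′ : ∀ (c : Pos (node _ ts)) → ⊤ →
               under-child i Y c ≢ true → ∃[ d ] under-child i Y d ≡ true × Meet ⊕op c d
    maximal′ (child j p) _ ¬Yp with j ≟ i
    ... | yes refl =
      let d , Yd , m = maximal p tt ¬Yp in child i d , trans (under-child-≡ {⊕op} {ts} i Y d) Yd , under m
    ... | no j≢i =
      let d , Yd = MaxClique-member (valid-child valid i) K in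
      child i d , trans (under-child-≡ {⊕op} {ts} i Y d) Yd , split j≢i

-- Formulas and parameters for the order

relF : ∀ {i j} → Op → Fin i → Fin i → Formula i j
relF ⊗op x y = edg x y
relF ⊕op x y = conj (neg (eq x y)) (neg (edg x y))

linkedF : ∀ {i j} → Op → Fin i → Fin i → Fin i → Formula i j
linkedF o p q r = ex₁ (conj
  (conj (neg (relF o (suc r) zero)) (neg (relF o zero (suc p))))
  (conj (neg (relF (dual o) (suc r) (suc q))) (neg (relF (dual o) zero (suc q)))))

kernelF : ∀ {i j} → Op → Fin i → Fin i → Fin j → Formula i j
kernelF o p q Z = ex₂ (conj
  (neg (ex₁ (conj (mem zero zero) (neg (conj (linkedF o (suc p) (suc q) zero) (mem zero (suc Z)))))))
  (conj
    (neg (ex₁ (ex₁ (conj (conj (mem (suc zero) zero) (mem zero zero)) (relF ⊕op (suc zero) zero)))))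
    (neg (ex₁ (conj (linkedF o (suc p) (suc q) zero)
                    (conj (neg (mem zero zero))
                          (neg (ex₁ (conj (mem zero zero) (relF ⊕op (suc zero) zero))))))))))

relF-Sat : ∀ {T i j} o x y {ρ : Fin i → Pos T} {σ : Fin j → Pos T → Bool} →
           SatT ρ σ (relF o x y) ⇔ Meet o (ρ x) (ρ y)
relF-Sat ⊗op x y = mk⇔ id id
relF-Sat ⊕op x y {ρ} = mk⇔ meet λ m →
  (λ e → Meet-irrefl (subst (Meet ⊕op (ρ x)) (sym e) m)) , Meet-exclusive m
  where
  meet : ¬ (ρ x ≡ ρ y) × ¬ Meet ⊗op (ρ x) (ρ y) → Meet ⊕op (ρ x) (ρ y)
  meet (≢ , ¬⊗) with compare (ρ x) (ρ y)
  ... | equal e     = contradiction e ≢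
  ... | meets ⊕op m = m
  ... | meets ⊗op m = contradiction m ¬⊗

linkedF-Sat : ∀ {T i j} o p q r {ρ : Fin i → Pos T} {σ : Fin j → Pos T → Bool} →
              ValidCotree T → Meet o (ρ p) (ρ q) →
              SatT ρ σ (linkedF o p q r) ⇔ Comp (ρ p) (ρ q) (ρ r)
linkedF-Sat o p q r {ρ} {σ} valid m = mk⇔
  (λ (e , (¬re , ¬ep) , (¬rq , ¬eq)) → Linked⇒Comp m
    (e , (¬re ∘ back (rel o _ _) , ¬ep ∘ back (rel o _ _)) ,
         (¬rq ∘ back (rel (dual o) _ _) , ¬eq ∘ back (rel (dual o) _ _))))
  (λ c → let e , (¬re , ¬ep) , (¬rq , ¬eq) = Comp⇒Linked valid m c in
    e , (¬re ∘ forth (rel o _ _) , ¬ep ∘ forth (rel o _ _)) ,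
        (¬rq ∘ forth (rel (dual o) _ _) , ¬eq ∘ forth (rel (dual o) _ _)))
  where
  rel : ∀ {e} o x y → SatT (extend e ρ) σ (relF o x y) ⇔ Meet o (extend e ρ x) (extend e ρ y)
  rel {e} o x y = relF-Sat o x y {extend e ρ} {σ}

-- The formula expresses universal statements and implications by negated existence, so satisfaction
-- yields them only up to double negation. Decidability of `Comp`, of `Meet` and of existence over
-- leaves removes it.
kernelF-Sat : ∀ {T i j} o p q Z {ρ : Fin i → Pos T} {σ : Fin j → Pos T → Bool} →
              ValidCotree T → Meet o (ρ p) (ρ q) →
              SatT ρ σ (kernelF o p q Z) ⇔ Kernel (Comp (ρ p) (ρ q)) (σ Z)
kernelF-Sat {T} o p q Z {ρ} {σ} valid m = mk⇔ kernel satisfied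
  where
  comp : ∀ {Y} c → SatT (extend c ρ) (extend Y σ) (linkedF o (suc p) (suc q) zero) ⇔ Comp (ρ p) (ρ q) c
  comp {Y} c = linkedF-Sat o (suc p) (suc q) zero {extend c ρ} {extend Y σ} valid m
  rel : ∀ {Y} c d → SatT (extend d (extend c ρ)) (extend Y σ) (relF ⊕op (suc zero) zero) ⇔ Meet ⊕op c d
  rel {Y} c d = relF-Sat ⊕op (suc zero) zero {extend d (extend c ρ)} {extend Y σ}
  kernel : SatT ρ σ (kernelF o p q Z) → Kernel (Comp (ρ p) (ρ q)) (σ Z)
  kernel (Y , ⊆ , clique , maximal) = Y
    , (λ c Yc → decidable-stable (Comp? (ρ p) (ρ q) c ×-dec (σ Z c Bool.≟ true))
        λ ¬in → ⊆ (c , Yc , λ (l , z) → ¬in (forth (comp {Y} c) l , z)))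
    , (λ c d Yc Yd cd → clique (c , d , (Yc , Yd) , back (rel {Y} c d) cd))
    , (λ c Cc ¬Yc → decidable-stable (any-Pos? T λ d → (Y d Bool.≟ true) ×-dec Meet? ⊕op c d)
        λ none → maximal (c , back (comp {Y} c) Cc , ¬Yc ,
          λ (d , Yd , cd) → none (d , Yd , forth (rel {Y} c d) cd)))
  satisfied : Kernel (Comp (ρ p) (ρ q)) (σ Z) → SatT ρ σ (kernelF o p q Z)
  satisfied (Y , ⊆ , clique , maximal) = Y
    , (λ (c , Yc , ¬in) → let Cc , Zc = ⊆ c Yc in ¬in (back (comp {Y} c) Cc , Zc))
    , (λ (c , d , (Yc , Yd) , cd) → clique c d Yc Yd (forth (rel {Y} c d) cd))
    , (λ (c , l , ¬Yc , none) → let d , Yd , cd = maximal c (forth (comp {Y} c) l) ¬Yc in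
        none (d , Yd , back (rel {Y} c d) cd))

-- Lexicographic comparison and the order formula

lexStep : Bool → Bool → Bool → Bool
lexStep false true  _ = true
lexStep true  false _ = false
lexStep false false r = r
lexStep true  true  r = r

lex : ∀ {m} → (Fin m → Bool) → (Fin m → Bool) → Bool
lex {zero}  x y = false
lex {suc m} x y = lexStep (x zero) (y zero) (lex (x ∘ suc) (y ∘ suc))

lexF : ∀ {m j} → (Fin m → Formula 2 j) → (Fin m → Formula 2 j) → Formula 2 j
-- Falsity, since the comparison is strict.
lexF {zero}  φ ψ = neg (eq zero zero)
lexF {suc m} φ ψ = conj
  -- Never 1 against 0; and either 0 against 1 or a decision by the remaining positions, written as
  -- a negated conjunction.
  (neg (conj (φ zero) (neg (ψ zero))))
  (neg (conj (neg (conj (neg (φ zero)) (ψ zero))) (neg (lexF (φ ∘ suc) (ψ ∘ suc)))))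

lexStep-reflects : ∀ {X Y R : Set} {x y r} → Reflects X x → Reflects Y y → Reflects R r →
  Reflects (¬ (X × ¬ Y) × ¬ (¬ (¬ X × Y) × ¬ R)) (lexStep x y r)
lexStep-reflects (ofʸ x)  (ofʸ y)  (ofʸ r)  = ofʸ ((λ (_ , ¬y) → ¬y y) , λ (_ , ¬r) → ¬r r)
lexStep-reflects (ofʸ x)  (ofʸ y)  (ofⁿ ¬r) = ofⁿ λ (_ , h) → h ((λ (¬x , _) → ¬x x) , ¬r)
lexStep-reflects (ofʸ x)  (ofⁿ ¬y) _        = ofⁿ λ (h , _) → h (x , ¬y)
lexStep-reflects (ofⁿ ¬x) (ofʸ y)  _        = ofʸ ((λ (x , _) → ¬x x) , λ (h , _) → h (¬x , y))
lexStep-reflects (ofⁿ ¬x) (ofⁿ ¬y) (ofʸ r)  = ofʸ ((λ (x , _) → ¬x x) , λ (_ , ¬r) → ¬r r)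
lexStep-reflects (ofⁿ ¬x) (ofⁿ ¬y) (ofⁿ ¬r) = ofⁿ λ (_ , h) → h ((λ (_ , y) → ¬y y) , ¬r)

lexF-reflects : ∀ {T m j} {ρ : Fin 2 → Pos T} {σ : Fin j → Pos T → Bool} {x y : Fin m → Bool} {φ ψ} →
  (∀ l → Reflects (SatT ρ σ (φ l)) (x l)) → (∀ l → Reflects (SatT ρ σ (ψ l)) (y l)) →
  Reflects (SatT ρ σ (lexF φ ψ)) (lex x y)
lexF-reflects {m = zero}  _  _  = ofⁿ λ ¬refl → ¬refl refl
lexF-reflects {m = suc m} rx ry =
  lexStep-reflects (rx zero) (ry zero) (lexF-reflects (rx ∘ suc) (ry ∘ suc))

lex-irrefl : ∀ {m} (x : Fin m → Bool) → lex x x ≢ true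
lex-irrefl {suc m} x with x zero
... | false = lex-irrefl (x ∘ suc)
... | true  = lex-irrefl (x ∘ suc)

lex-trans : ∀ {m} {x y z : Fin m → Bool} → lex x y ≡ true → lex y z ≡ true → lex x z ≡ true
lex-trans {suc m} {x} {y} {z} xy yz with x zero | y zero | z zero
... | false | false | false = lex-trans {m} xy yz
... | false | false | true  = refl
... | false | true  | true  = refl
... | true  | true  | true  = lex-trans {m} xy yz

lex-total : ∀ {m} (x y : Fin m → Bool) → (∀ l → x l ≡ y l) ⊎ (lex x y ≡ true ⊎ lex y x ≡ true)
lex-total {zero}  x y = inj₁ λ ()
lex-total {suc m} x y with x zero in ex | y zero in ey | lex-total (x ∘ suc) (y ∘ suc)
... | false | true  | _      = inj₂ (inj₁ refl)
... | true  | false | _      = inj₂ (inj₂ refl)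
... | false | false | inj₂ r = inj₂ r
... | true  | true  | inj₂ r = inj₂ r
... | false | false | inj₁ e = inj₁ λ { zero → trans ex (sym ey) ; (suc l) → e l }
... | true  | true  | inj₁ e = inj₁ λ { zero → trans ex (sym ey) ; (suc l) → e l }

-- Siblings are told apart by which of the sets P l contain a maximal clique of them.
data Separating {m : ℕ} : (T : Cotree) → (Fin m → Pos T → Bool) → Set where
  leaf : ∀ {P} → Separating leaf P
  node : ∀ {o ts P} (bits : Fin (length ts) → Fin m → Bool) →
         (∀ i l → Reflects (MaxClique (lookup ts i) (P l ∘ child i)) (bits i l)) →
         (∀ i j → (∀ l → bits i l ≡ bits j l) → i ≡ j) →
         (∀ i → Separating (lookup ts i) (λ l → P l ∘ child i)) →
         Separating (node o ts) P

data Before {m : ℕ} : ∀ {T} {P : Fin m → Pos T → Bool} → Separating T P → Pos T → Pos T → Set where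
  split : ∀ {o ts P bits reflects distinct below i j p q} → i ≢ j → lex (bits i) (bits j) ≡ true →
          Before (node {o = o} {ts} {P} bits reflects distinct below) (child i p) (child j q)
  under : ∀ {o ts P bits reflects distinct below i p q} → Before (below i) p q →
          Before (node {o = o} {ts} {P} bits reflects distinct below) (child i p) (child i q)

module _ {m : ℕ} where

  Before-irrefl : ∀ {T} {P : Fin m → Pos T → Bool} {S : Separating T P} {p} → ¬ Before S p p
  Before-irrefl (split i≢i _) = i≢i refl
  Before-irrefl (under b)     = Before-irrefl b

  Before-trans : ∀ {T} {P : Fin m → Pos T → Bool} {S : Separating T P} {p q r} →
                 Before S p q → Before S q r → Before S p r
  Before-trans {p = child i _} {r = child k _} (split {bits = bits} i≢j x) (split {j = k} j≢k y) with i ≟ k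
  ... | yes refl = contradiction (lex-trans {x = bits i} {z = bits i} x y) (lex-irrefl (bits i))
  ... | no i≢k   = split i≢k (lex-trans {x = bits i} {z = bits k} x y)
  Before-trans (split i≢j x) (under c)     = split i≢j x
  Before-trans (under b)     (split j≢k y) = split j≢k y
  Before-trans (under b)     (under c)     = under (Before-trans b c)

  Before-total : ∀ {T} {P : Fin m → Pos T → Bool} (S : Separating T P) p q →
                 p ≡ q ⊎ (Before S p q ⊎ Before S q p)
  Before-total leaf root root = inj₁ refl
  Before-total (node bits reflects distinct below) (child i p) (child j q) with i ≟ j
  ... | no i≢j with lex-total (bits i) (bits j)
  ...   | inj₁ e        = contradiction (distinct i j e) i≢j
  ...   | inj₂ (inj₁ x) = inj₂ (inj₁ (split i≢j x))
  ...   | inj₂ (inj₂ y) = inj₂ (inj₂ (split (i≢j ∘ sym) y))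
  Before-total (node bits reflects distinct below) (child i p) (child j q)
      | yes refl with Before-total (below i) p q
  ...   | inj₁ e        = inj₁ (cong (child i) e)
  ...   | inj₂ (inj₁ b) = inj₂ (inj₁ (under b))
  ...   | inj₂ (inj₂ b) = inj₂ (inj₂ (under b))

reflects-⇔ : ∀ {A B : Set} {b} → A ⇔ B → Reflects A b → Reflects B b
reflects-⇔ e (ofʸ a)  = ofʸ (forth e a)
reflects-⇔ e (ofⁿ ¬a) = ofⁿ (¬a ∘ back e)

Comp-split-kernel : ∀ {o ts i j p q Q} → i ≢ j →
  MaxClique (lookup ts i) (Q ∘ child i) ⇔ Kernel (Comp (child {o} {ts} i p) (child j q)) Q
Comp-split-kernel {i = i} i≢j = Kernel-child i (λ r → mk⇔ (λ _ → split i≢j) (λ _ → tt))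
  λ { _ (split _) → _ , refl ; _ (under _) → _ , refl }

Comp-under-kernel : ∀ {o ts i p q Q} →
  Kernel (Comp p q) (Q ∘ child i) ⇔ Kernel (Comp (child {o} {ts} i p) (child i q)) Q
Comp-under-kernel {i = i} = Kernel-child i
  (λ r → mk⇔ under λ { (split i≢i) → contradiction refl i≢i ; (under c) → c })
  λ { _ (split _) → _ , refl ; _ (under _) → _ , refl }

-- The comparison is settled at the least common ancestor, where `Comp p q` and `Comp q p` are the
-- two children involved. The bits found there pass upwards unchanged, since these kernels do not
-- depend on the surrounding tree.
sibling-bits : ∀ {m T o} {P : Fin m → Pos T → Bool} (S : Separating T P) {p q} → Meet o p q →
  ∃₂ λ x y → (∀ l → Reflects (Kernel (Comp p q) (P l)) (x l)) ×
             (∀ l → Reflects (Kernel (Comp q p) (P l)) (y l)) ×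
             Reflects (Before S p q) (lex x y)
sibling-bits (node bits reflects distinct below) (split {i = i} {j} i≢j) = bits i , bits j ,
  (λ l → reflects-⇔ (Comp-split-kernel i≢j) (reflects i l)) ,
  (λ l → reflects-⇔ (Comp-split-kernel (i≢j ∘ sym)) (reflects j l)) ,
  lex-reflects (lex (bits i) (bits j)) refl
  where
  lex-reflects : ∀ b → lex (bits i) (bits j) ≡ b → Reflects (Before _ (child i _) (child j _)) b
  lex-reflects true  e = ofʸ (split i≢j e)
  lex-reflects false e = ofⁿ λ { (split _ t) → contradiction (trans (sym t) e) λ ()
                               ; (under _)   → i≢j refl }
sibling-bits (node bits reflects distinct below) (under {i = i} meet) =
  let x , y , rx , ry , rb = sibling-bits (below i) meet in x , y ,
  (λ l → reflects-⇔ Comp-under-kernel (rx l)) ,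
  (λ l → reflects-⇔ Comp-under-kernel (ry l)) ,
  reflects-⇔ (mk⇔ under λ { (split i≢i _) → contradiction refl i≢i ; (under b) → b }) rb

beforeF : ∀ m → Op → Formula 2 m
beforeF m o = lexF (kernelF o zero (suc zero)) (kernelF o (suc zero) zero)

-- `kernelF` needs the label of the least common ancestor, which is read off the edge relation: the
-- formula says that the leaves are equal, or that adjacency implies one comparison and nonadjacency
-- the other.
orderF : ∀ m → Formula 2 m
orderF m = neg (conj (neg (eq zero (suc zero))) (neg (conj
  (neg (conj (edg zero (suc zero)) (neg (beforeF m ⊗op))))
  (neg (conj (neg (edg zero (suc zero))) (neg (beforeF m ⊕op)))))))

module _ {m T} {P : Fin m → Pos T → Bool} (valid : ValidCotree T) (S : Separating T P) where

  beforeF-reflects : ∀ {o p q} → Meet o p q →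
                     ∃[ b ] Reflects (Before S p q) b × Reflects (SatT (pair p q) P (beforeF m o)) b
  beforeF-reflects {o} {p} {q} meet =
    let x , y , rx , ry , rb = sibling-bits S meet in lex x y , rb , lexF-reflects
      {φ = kernelF o zero (suc zero)} {kernelF o (suc zero) zero}
      (λ l → reflects-⇔ (⇔-sym (kernelF-Sat o zero (suc zero) l {pair p q} {P} valid meet)) (rx l))
      (λ l → reflects-⇔ (⇔-sym (kernelF-Sat o (suc zero) zero l {pair p q} {P} valid (Meet-sym meet))) (ry l))
    where
    ⇔-sym : ∀ {A B : Set} → A ⇔ B → B ⇔ A
    ⇔-sym e = mk⇔ (back e) (forth e)

  orderF-Sat : ∀ {p q} → SatT (pair p q) P (orderF m) ⇔ (p ≡ q ⊎ Before S p q)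
  orderF-Sat {p} {q} with compare p q
  ... | equal e = mk⇔ (λ _ → inj₁ e) (λ _ (≢ , _) → ≢ e)
  ... | meets ⊗op meet with beforeF-reflects meet
  ...   | _ , ofʸ b  , ofʸ s  = mk⇔ (λ _ → inj₂ b)
                                    (λ _ (_ , h) → h ((λ (_ , ¬s) → ¬s s) , λ (¬⊗ , _) → ¬⊗ meet))
  ...   | _ , ofⁿ ¬b , ofⁿ ¬s = mk⇔
    (λ h → contradiction ((λ { refl → Meet-irrefl meet }) , λ (g , _) → g (meet , ¬s)) h)
    [ (λ { refl → contradiction meet Meet-irrefl }) , (λ b → contradiction b ¬b) ]
  orderF-Sat {p} {q} | meets ⊕op meet with beforeF-reflects meet
  ...   | _ , ofʸ b  , ofʸ s  = mk⇔ (λ _ → inj₂ b)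
    (λ _ (_ , h) → h ((λ (⊗ , _) → Meet-exclusive meet ⊗) , λ (_ , ¬s) → ¬s s))
  ...   | _ , ofⁿ ¬b , ofⁿ ¬s = mk⇔
    (λ h → contradiction ((λ { refl → Meet-irrefl meet }) , λ (_ , g) → g (Meet-exclusive meet , ¬s)) h)
    [ (λ { refl → contradiction meet Meet-irrefl }) , (λ b → contradiction b ¬b) ]

-- Ternary codes and the choice of parameters

shift : Bool → Fin 3 → Fin 3
shift true  zero             = suc zero
shift true  (suc zero)       = suc (suc zero)
shift true  (suc (suc zero)) = zero
shift false zero             = suc (suc zero)
shift false (suc zero)       = zero
shift false (suc (suc zero)) = suc zero

shift-≢ : ∀ b z → shift b z ≢ z
shift-≢ true  zero ()
shift-≢ true  (suc zero) ()
shift-≢ true  (suc (suc zero)) ()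
shift-≢ false zero ()
shift-≢ false (suc zero) ()
shift-≢ false (suc (suc zero)) ()

shift-onto : ∀ z v → v ≢ z → ∃[ b ] shift b z ≡ v
shift-onto zero             zero             v≢z = contradiction refl v≢z
shift-onto zero             (suc zero)       _   = true , refl
shift-onto zero             (suc (suc zero)) _   = false , refl
shift-onto (suc zero)       zero             _   = false , refl
shift-onto (suc zero)       (suc zero)       v≢z = contradiction refl v≢z
shift-onto (suc zero)       (suc (suc zero)) _   = true , refl
shift-onto (suc (suc zero)) zero             _   = true , refl
shift-onto (suc (suc zero)) (suc zero)       _   = false , refl
shift-onto (suc (suc zero)) (suc (suc zero)) v≢z = contradiction refl v≢z

shift-injective : ∀ z {b b′} → shift b z ≡ shift b′ z → b ≡ b′
shift-injective _                {true}  {true}  _ = refl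
shift-injective _                {false} {false} _ = refl
shift-injective zero             {true}  {false} ()
shift-injective (suc zero)       {true}  {false} ()
shift-injective (suc (suc zero)) {true}  {false} ()
shift-injective zero             {false} {true}  ()
shift-injective (suc zero)       {false} {true}  ()
shift-injective (suc (suc zero)) {false} {true}  ()

-- The indicator vector of the coordinates smaller than `j`.
below : ∀ {r d} → Fin r → Fin d → Bool
below zero    _       = false
below (suc j) zero    = true
below (suc j) (suc c) = below j c

below-injective : ∀ {r d} → r ≤ d → (i j : Fin r) → (∀ (c : Fin d) → below i c ≡ below j c) → i ≡ j
below-injective _         zero    zero    _ = refl
below-injective (s≤s r≤d) zero    (suc j) e = contradiction (e zero) λ ()
below-injective (s≤s r≤d) (suc i) zero    e = contradiction (e zero) λ ()
below-injective (s≤s r≤d) (suc i) (suc j) e = cong suc (below-injective r≤d i j (e ∘ suc))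

-- Coordinate `j` exists because of `r ≤ d`, and the vector is 0 there.
below-not-full : ∀ {r d} → r ≤ d → (j : Fin r) → ¬ (∀ (c : Fin d) → true ≡ below j c)
below-not-full (s≤s r≤d) zero    e = contradiction (e zero) λ ()
below-not-full (s≤s r≤d) (suc j) e = below-not-full r≤d j (e ∘ suc)

-- Pairwise distinct 0-1 vectors such that every coordinate takes both values.
spread : ∀ {r d} → Fin r → Fin d → Bool
spread zero    _ = true
spread (suc j) c = below j c

-- Child 0 has the all-one vector and child 1 the all-zero vector.
spread-onto : ∀ {r d} → 2 ≤ r → (c : Fin d) → ∀ b → ∃[ j ] spread {r} j c ≡ b
spread-onto (s≤s (s≤s _)) c true  = zero , refl
spread-onto (s≤s (s≤s _)) c false = suc zero , refl

spread-injective : ∀ {r d} → r ≤ d → (i j : Fin r) →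
                   (∀ (c : Fin d) → spread i c ≡ spread j c) → i ≡ j
spread-injective r≤d       zero    zero    _ = refl
spread-injective (s≤s r≤d) zero    (suc j) e =
  contradiction e (below-not-full (≤-trans r≤d (n≤1+n _)) j)
spread-injective (s≤s r≤d) (suc i) zero    e =
  contradiction (sym ∘ e) (below-not-full (≤-trans r≤d (n≤1+n _)) i)
spread-injective (s≤s r≤d) (suc i) (suc j) e =
  cong suc (below-injective (≤-trans r≤d (n≤1+n _)) i j e)

module _ {d : ℕ} where

  -- A parameter is a pair of a coordinate and one of its three possible values; it tests the code
  -- for this value.
  coord : Fin (d * 3) → Fin d
  coord l = proj₁ (remQuot {d} 3 l)

  value : Fin (d * 3) → Fin 3
  value l = proj₂ (remQuot {d} 3 l)

  -- The sets containing a maximal clique of a subtree with code z, where o labels its root.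
  Code : Op → (Fin d → Fin 3) → Fin (d * 3) → Set
  Code ⊕op z l = value l ≢ z (coord l)
  Code ⊗op z l = value l ≡ z (coord l)

  Code? : ∀ o z l → Dec (Code o z l)
  Code? ⊕op z l = ¬? (value l ≟ z (coord l))
  Code? ⊗op z l = value l ≟ z (coord l)

  -- `shift` adds or subtracts one modulo 3. In each coordinate a child thus avoids the value of its
  -- parent, and one Boolean selects which of the other two it gets.
  childCode : ∀ {r} → (Fin d → Fin 3) → Fin r → Fin d → Fin 3
  childCode z j c = shift (spread j c) (z c)

  -- In each coordinate the children take only the two values other than that of `z`, and by
  -- `spread-onto` both occur.
  Code-⊕ : ∀ {r} → 2 ≤ r → ∀ z l → Code ⊕op z l ⇔ (∃[ j ] Code ⊗op (childCode {r} z j) l)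
  Code-⊕ 2≤r z l = mk⇔ find-child λ (j , e) e′ → shift-≢ (spread j (coord l)) _ (trans (sym e) e′)
    where
    find-child : Code ⊕op z l → ∃[ j ] Code ⊗op (childCode z j) l
    find-child v≢z with shift-onto (z (coord l)) (value l) v≢z
    ... | b , e with spread-onto 2≤r (coord l) b
    ...   | j , refl = j , sym e

  -- The complement of `Code-⊕`: a value avoided by all children is the one that `z` has in this
  -- coordinate.
  Code-⊗ : ∀ {r} → 2 ≤ r → ∀ z l → Code ⊗op z l ⇔ (∀ j → Code ⊕op (childCode {r} z j) l)
  Code-⊗ 2≤r z l = mk⇔
    (λ e j e′ → shift-≢ (spread j (coord l)) _ (trans (sym e′) e))
    (λ h → decidable-stable (value l ≟ z (coord l)) λ v≢z →
      let j , e = forth (Code-⊕ 2≤r z l) v≢z in h j e)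

  childCode-injective : ∀ {r} → r ≤ d → ∀ z (i j : Fin r) →
                        (∀ c → childCode z i c ≡ childCode z j c) → i ≡ j
  childCode-injective r≤d z i j e = spread-injective r≤d i j λ c → shift-injective (z c) (e c)

  Code-separates : ∀ o z z′ → (∀ l → does (Code? o z l) ≡ does (Code? o z′ l)) → ∀ c → z c ≡ z′ c
  Code-separates o z z′ e c = Code-agrees o (does-transfer (Code? o z l) (Code? o z′ l) (e l))
                                            (does-transfer (Code? o z′ l) (Code? o z l) (sym (e l)))
    where
    -- The parameter that tests coordinate `c` for the value of `z` itself.
    l = combine c (z c)
    coord-l : coord l ≡ c
    coord-l = cong proj₁ (remQuot-combine c (z c))
    value-l : value l ≡ z c
    value-l = cong proj₂ (remQuot-combine c (z c))
    Code-agrees : ∀ o → (Code o z l → Code o z′ l) → (Code o z′ l → Code o z l) → z c ≡ z′ c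
    Code-agrees ⊕op f g = decidable-stable (z c ≟ z′ c) λ ≢ →
      g (λ e → ≢ (trans (sym value-l) (trans e (cong z′ coord-l)))) (trans value-l (cong z (sym coord-l)))
    Code-agrees ⊗op f g = trans (sym value-l)
      (trans (f (trans value-l (cong z (sym coord-l)))) (cong z′ coord-l))

  outdeg-child : ∀ ts i → outdeg (lookup ts i) ≤ outdegs ts
  outdeg-child (T ∷ ts) zero    = m≤m⊔n _ _
  outdeg-child (T ∷ ts) (suc i) = ≤-trans (outdeg-child ts i) (m≤n⊔m _ _)

  dual-involutive : ∀ o → dual (dual o) ≡ o
  dual-involutive ⊕op = refl
  dual-involutive ⊗op = refl

  -- The code `z` is arbitrary so that the parent can prescribe it. `o` is separate from the label
  -- because a leaf may be treated as a node of either kind, to match its siblings.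
  Labelling : Cotree → Set
  Labelling T = ValidCotree T → outdeg T ≤ d → ∀ o → label T ≢ just (dual o) → ∀ z →
    ∃[ P ] (∀ l → MaxClique T (P l) ⇔ Code o z l) × Separating {d * 3} T P

  labelling : ∀ T → Labelling T
  labelling = Cotree-ind Labelling label-leaf label-node
    where
    label-leaf : Labelling leaf
    -- The single vertex is the only maximal clique, so it is put into exactly the sets that the
    -- code demands.
    label-leaf _ _ o _ z = (λ l _ → does (Code? o z l)) ,
      (λ l → mk⇔ (λ K → does⇒ (Code? o z l) (forth MaxClique-leaf K))
                 (λ c → back MaxClique-leaf (dec-true (Code? o z l) c))) , leaf
      where
      does⇒ : ∀ {A : Set} (A? : Dec A) → does A? ≡ true → A
      does⇒ (yes a) _ = a
    label-node : ∀ o ts → (∀ i → Labelling (lookup ts i)) → Labelling (node o ts)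
    label-node o ts rec valid@(node-valid _ _ 2≤r _ _) bound o′ label≢ z
      -- At an inner node the condition on the label forces `o′` to be `o`.
      with trans (sym (dual-involutive o′)) (sym (dual-of-≢ (label≢ ∘ cong just)))
    ... | refl = P , values o valid P (λ i → proj₁ (proj₂ (sub i))) , separating
      where
      sub : ∀ i → ∃[ P ] (∀ l → MaxClique (lookup ts i) (P l) ⇔ Code (dual o) (childCode z i) l) ×
                         Separating (lookup ts i) P
      sub i = rec i (valid-child valid i) (≤-trans (outdeg-child ts i) (m⊔n≤o⇒n≤o (length ts) _ bound))
                  (dual o) (λ e → child-label valid i (trans e (cong just (dual-involutive o))))
                  (childCode z i)
      P : Fin (d * 3) → Pos (node o ts) → Bool
      P l (child i p) = proj₁ (sub i) l p
      values : ∀ o → ValidCotree (node o ts) → (P : Fin (d * 3) → Pos (node o ts) → Bool) →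
               (∀ i l → MaxClique (lookup ts i) (P l ∘ child i) ⇔ Code (dual o) (childCode z i) l) →
               ∀ l → MaxClique (node o ts) (P l) ⇔ Code o z l
      values ⊕op valid P sub l = mk⇔
        (λ K → let i , Ki = forth (MaxClique-⊕ valid) K in back (Code-⊕ 2≤r z l) (i , forth (sub i l) Ki))
        (λ c → let i , ci = forth (Code-⊕ 2≤r z l) c in back (MaxClique-⊕ valid) (i , back (sub i l) ci))
      values ⊗op valid P sub l = mk⇔
        (λ K → back (Code-⊗ 2≤r z l) λ i → forth (sub i l) (forth MaxClique-⊗ K i))
        (λ c → back MaxClique-⊗ λ i → back (sub i l) (forth (Code-⊗ 2≤r z l) c i))
      separating : Separating (node o ts) P
      separating = node (λ i l → does (Code? (dual o) (childCode z i) l))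
        (λ i l → reflects-⇔ (mk⇔ (back (proj₁ (proj₂ (sub i)) l)) (forth (proj₁ (proj₂ (sub i)) l)))
                            (proof (Code? (dual o) (childCode z i) l)))
        (λ i j e → childCode-injective (m⊔n≤o⇒m≤o _ _ bound) z i j (Code-separates (dual o) _ _ e))
        (λ i → proj₂ (proj₂ (sub i)))

root-mode : ∀ T → ∃[ o ] label T ≢ just (dual o)
root-mode leaf        = ⊕op , λ ()
root-mode (node o ts) = o , λ e → dual≢ (just-injective e)

order-from-separating : ∀ G {m T} (L : Leaves (raw G) T) {P : Fin m → Pos T → Bool} → ValidCotree T →
  Separating T P →
  IsTotalOrder _≡_ (λ x y → Sat (raw G) (pair x y) (λ l → P l ∘ Leaves.to L) (orderF m))
order-from-separating G {m} L {P} valid S = record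
  { isPartialOrder = record
    { isPreorder = record
      { isEquivalence = isEquivalence
      ; reflexive     = λ { refl → back ⇔ᵒ (inj₁ refl) }
      ; trans         = λ xy yz → back ⇔ᵒ (trans′ (forth ⇔ᵒ xy) (forth ⇔ᵒ yz))
      }
    ; antisym = λ xy yx → antisym′ (forth ⇔ᵒ xy) (forth ⇔ᵒ yx)
    }
  ; total = λ x y → total′ (Before-total S (Leaves.to L x) (Leaves.to L y))
  }
  where
  pos = Leaves.to L
  _≤ᵒ_ = λ x y → pos x ≡ pos y ⊎ Before S (pos x) (pos y)
  Sat≤ = λ x y → Sat (raw G) (pair x y) (λ l → P l ∘ pos) (orderF m)
  ⇔ᵒ : ∀ {x y} → Sat≤ x y ⇔ (x ≤ᵒ y)
  ⇔ᵒ {x} {y} = mk⇔ (forth (orderF-Sat valid S) ∘ forth moved) (back moved ∘ back (orderF-Sat valid S))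
    where
    moved = Sat⇔SatT G L (orderF m) {pair x y} {λ l → P l ∘ pos} {pair (pos x) (pos y)} {P}
              (λ { zero → refl ; (suc zero) → refl }) (λ _ _ → refl)
  trans′ : ∀ {x y z} → x ≤ᵒ y → y ≤ᵒ z → x ≤ᵒ z
  trans′ {z = z} (inj₁ e) yz = subst (λ p → p ≡ pos z ⊎ Before S p (pos z)) (sym e) yz
  trans′ {x} (inj₂ b) (inj₁ e) = inj₂ (subst (Before S (pos x)) e b)
  trans′ (inj₂ b) (inj₂ c) = inj₂ (Before-trans b c)
  antisym′ : ∀ {x y} → x ≤ᵒ y → y ≤ᵒ x → x ≡ y
  antisym′ (inj₁ e) _        = to-injective G L e
  antisym′ (inj₂ _) (inj₁ e) = to-injective G L (sym e)
  antisym′ (inj₂ b) (inj₂ c) = contradiction (Before-trans b c) Before-irrefl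
  total′ : ∀ {x y} → pos x ≡ pos y ⊎ (Before S (pos x) (pos y) ⊎ Before S (pos y) (pos x)) →
           Sat≤ x y ⊎ Sat≤ y x
  total′ (inj₁ e)        = inj₁ (back ⇔ᵒ (inj₁ e))
  total′ (inj₂ (inj₁ b)) = inj₁ (back ⇔ᵒ (inj₂ b))
  total′ (inj₂ (inj₂ b)) = inj₂ (back ⇔ᵒ (inj₂ b))

bounded⇒orderable : ∀ 𝒞 → (∀ G → 𝒞 G → IsCograph G) → BoundedCotreeOutdeg 𝒞 → MSO₁-orderable 𝒞
bounded⇒orderable 𝒞 cograph (d , bounded) = d * 3 , orderF (d * 3) , λ G G∈𝒞 _ →
  let T , valid , iso = cograph G G∈𝒞
      o , label≢      = root-mode T
      -- The root has no siblings, so any code will do there.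
      P , _ , S       = labelling T valid (bounded G G∈𝒞 T valid iso) o label≢ (λ _ → zero)
      L               = ≅⇒Leaves iso
  in (λ l → P l ∘ Leaves.to L) , order-from-separating G L valid S

theorem5p15 : (𝒞 : Class) → (∀ G → 𝒞 G → IsCograph G) →
    (MSO₁-orderable 𝒞 ⇔ HasCUT 𝒞) × (HasCUT 𝒞 ⇔ BoundedCotreeOutdeg 𝒞)
theorem5p15 𝒞 cograph =
  mk⇔ (orderable⇒CUT 𝒞) (bounded⇒orderable 𝒞 cograph ∘ CUT⇒bounded 𝒞) ,
  mk⇔ (CUT⇒bounded 𝒞) (orderable⇒CUT 𝒞 ∘ bounded⇒orderable 𝒞 cograph)
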